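{- Let $d\ge1$, let $\Delta$ be a $d$-dimensional orientable pseudomanifold without boundary with $s=f_d(\Delta)$ facets, and let $G$ be the facet-ridge graph of $\Delta$. Then (1) $\mathcal{P}_\Delta$ is unimodularly equivalent to the symmetric edge polytope $\mathcal{P}_{C_s}$ of the cycle graph $C_s$ on $s$ vertices, and (2) $\mathcal{P}^\Delta$ is unimodularly equivalent to the symmetric edge polytope $\mathcal{P}_G$.
   Context: For $j\ge1$ the boundary map $\partial_j$ of a simplicial complex on $[n]$ sends $\{i_1<\dots<i_{j+1}\}$ to $\sum_k(-1)^{k+1}(\sigma\setminus\{i_k\})$, identified with its integer matrix. For $d=\dim\Delta$: $\mathcal{P}_\Delta=\operatorname{conv}$ of the columns of $\partial_d$ and $-\partial_d$; $\mathcal{P}^\Delta=\operatorname{conv}$ of the columns of $\partial_d^\top$ and $-\partial_d^\top$. For a graph $G$, the symmetric edge polytope is $\mathcal{P}_G=\operatorname{conv}$ of the columns of $\partial_1$ and $-\partial_1$, where $\partial_1$ is the (directed) incidence matrix of $G$ viewed as a 1-dimensional complex. A $d$-pseudomanifold is a pure complex where each $(d-1)$-face lies in at most two facets and that is strongly connected via $(d-1)$-faces; it is without boundary if every $(d-1)$-face lies in exactly two facets, and then orientable if $H_d(\Delta;\mathbb{Z})\cong\mathbb{Z}$. The facet-ridge graph has the facets as vertices, two facets adjacent iff they share a $(d-1)$-face. Polytopes $P,Q$ are unimodularly equivalent if, after possibly embedding them in a common space by adding coordinates, $P=UQ$ for an integer matrix $U$ with $|\det U|=1$. -}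

module Defs where

open import Data.Nat as ℕ using (ℕ; zero; suc; _≡ᵇ_; _≤ᵇ_)
open import Data.Integer as ℤ using (ℤ; +_)
open import Data.Rational as ℚ using (ℚ; 0ℚ; 1ℚ)
open import Data.Fin using (Fin; zero; suc; toℕ; inject≤; splitAt; punchIn)
open import Data.Fin.Subset using (Subset; ∣_∣; _∩_)
open import Data.Bool using (Bool; true; false; _∧_; _∨_; not; if_then_else_)
open import Data.Vec using (Vec; []; _∷_)
open import Data.List as List using (List; []; _∷_; _++_; filterᵇ; length; lookup; allFin)
open import Data.Maybe using (Maybe; just; nothing)
open import Data.Sum using (_⊎_; inj₁; inj₂; [_,_]′)
open import Data.Product using (Σ; ∃; _×_; _,_)
open import Function.Bundles using (_⇔_)
open import Relation.Binary.PropositionalEquality using (_≡_; _≢_)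
open import Relation.Binary.Construct.Closure.ReflexiveTransitive using (Star)
open import Relation.Nullary using (¬_)
open import Relation.Nullary.Decidable using (⌊_⌋)

allSubsets : ∀ n → List (Subset n)
allSubsets zero    = [] ∷ []
allSubsets (suc n) = List.map (true ∷_) (allSubsets n) ++ List.map (false ∷_) (allSubsets n)

_⊆ᵇ_ : ∀ {n} → Subset n → Subset n → Bool
[] ⊆ᵇ [] = true
(t ∷ τ) ⊆ᵇ (s ∷ σ) = (not t ∨ s) ∧ (τ ⊆ᵇ σ)

_≟ˢ_ : ∀ {n} → Subset n → Subset n → Bool
[] ≟ˢ [] = true
(t ∷ τ) ≟ˢ (s ∷ σ) = (if t then s else not s) ∧ (τ ≟ˢ σ)

Complex : ℕ → Set
Complex n = Subset n → Bool

IsSimplicialComplex : ∀ {n} → Complex n → Set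
IsSimplicialComplex {n} K = ∀ (σ τ : Subset n) → (τ ⊆ᵇ σ) ≡ true → K σ ≡ true → K τ ≡ true

faces : ∀ {n} → Complex n → ℕ → List (Subset n)
faces {n} K j = filterᵇ (λ σ → K σ ∧ (∣ σ ∣ ≡ᵇ suc j)) (allSubsets n)

f : ∀ {n} → Complex n → ℕ → ℕ
f K j = length (faces K j)

jFace : ∀ {n} (K : Complex n) (j : ℕ) → Fin (f K j) → Subset n
jFace K j = lookup (faces K j)

-- Boundary map.  If σ = τ ∪ {i} with i ∉ τ, `removed τ σ` returns
-- just k where k = #{elements of σ smaller than i} (so i = i_{k+1});
-- otherwise nothing.

removed : ∀ {n} → Subset n → Subset n → Maybe ℕ
removed [] [] = nothing
removed (false ∷ τ) (false ∷ σ) = removed τ σ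
removed (true ∷ τ) (true ∷ σ) = Data.Maybe.map suc (removed τ σ)
removed (false ∷ τ) (true ∷ σ) = if τ ≟ˢ σ then just 0 else nothing
removed (true ∷ τ) (false ∷ σ) = nothing

sign : ℕ → ℤ
sign zero = + 1
sign (suc k) = ℤ.- sign k

-- coefficient of τ in ∂σ : (-1)^{(k+1)+1} when τ = σ \ {i_{k+1}}
bdCoeff : ∀ {n} → Subset n → Subset n → ℤ
bdCoeff τ σ with removed τ σ
... | nothing = + 0
... | just k  = sign k

-- ∂_j as an integer matrix : rows = (j-1)-faces, columns = j-faces   (j ≥ 1)
∂ : ∀ {n} (K : Complex n) (j : ℕ) → Fin (f K (ℕ.pred j)) → Fin (f K j) → ℤ
∂ K j r c = bdCoeff (jFace K (ℕ.pred j) r) (jFace K j c)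

Point : ℕ → Set
Point m = Fin m → ℤ

ι : ℤ → ℚ
ι z = z ℚ./ 1

Σℚ : ∀ k → (Fin k → ℚ) → ℚ
Σℚ zero g = 0ℚ
Σℚ (suc k) g = g zero ℚ.+ Σℚ k (λ i → g (suc i))

Poly : ℕ → Set₁
Poly m = (Fin m → ℚ) → Set

conv : ∀ {m k} → (Fin k → Point m) → Poly m
conv {m} {k} p x =
  Σ (Fin k → ℚ) λ λs →
    (∀ c → 0ℚ ℚ.≤ λs c) × (Σℚ k λs ≡ 1ℚ) ×
    (∀ i → x i ≡ Σℚ k (λ c → λs c ℚ.* ι (p c i)))

pm : ∀ {m k} → (Fin k → Point m) → Fin (k ℕ.+ k) → Point m
pm {m} {k} p i = [ p , (λ c r → ℤ.- p c r) ]′ (splitAt k i)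

symConvCols : ∀ {a k} → (Fin a → Fin k → ℤ) → Poly a
symConvCols A = conv (pm (λ c r → A r c))

symConvRows : ∀ {a k} → (Fin a → Fin k → ℤ) → Poly k
symConvRows A = conv (pm (λ r c → A r c))

Psub : ∀ {n} (K : Complex n) (d : ℕ) → Poly (f K (ℕ.pred d))
Psub K d = symConvCols (∂ K d)

Psup : ∀ {n} (K : Complex n) (d : ℕ) → Poly (f K d)
Psup K d = symConvRows (∂ K d)

det : ∀ {m} → (Fin m → Fin m → ℤ) → ℤ
det {zero} A = + 1
det {suc m} A = go (suc m) (λ j → j)
  where
  minor : Fin (suc m) → Fin m → Fin m → ℤ
  minor j r c = A (suc r) (punchIn j c)
  go : ∀ k → (Fin k → Fin (suc m)) → ℤ
  go zero    col = + 0
  go (suc k) col = sign (toℕ (col zero)) ℤ.* A zero (col zero) ℤ.* det (minor (col zero))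
                   ℤ.+ go k (λ i → col (suc i))

apply : ∀ {m} → (Fin m → Fin m → ℤ) → (Fin m → ℚ) → Fin m → ℚ
apply {m} U y i = Σℚ m (λ k → ι (U i k) ℚ.* y k)

pad : ∀ {a m} → a ℕ.≤ m → Poly a → Poly m
pad {a} a≤m P x = (∀ i → a ℕ.≤ toℕ i → x i ≡ 0ℚ) × P (λ j → x (inject≤ j a≤m))

UnimodEquiv : ∀ {a b} → Poly a → Poly b → Set
UnimodEquiv {a} {b} P Q =
  Σ ℕ λ m → Σ (a ℕ.≤ m) λ a≤m → Σ (b ℕ.≤ m) λ b≤m →
  Σ (Fin m → Fin m → ℤ) λ U → (ℤ.∣ det U ∣ ≡ 1) ×
    (∀ x → pad a≤m P x ⇔ (Σ (Fin m → ℚ) λ y → pad b≤m Q y × (∀ i → x i ≡ apply U y i)))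

allB : ∀ {A : Set} → (A → Bool) → List A → Bool
allB g xs = List.foldr (λ x b → g x ∧ b) true xs

graphComplex : ∀ {s} → (Fin s → Fin s → Bool) → Complex s
graphComplex {s} adj σ =
  (∣ σ ∣ ≤ᵇ 1) ∨
  ((∣ σ ∣ ≡ᵇ 2) ∧
   allB (λ i → allB (λ j → not (Data.Vec.lookup σ i ∧ Data.Vec.lookup σ j)
                          ∨ (toℕ i ≡ᵇ toℕ j) ∨ adj i j) (allFin s)) (allFin s))

SymEdgePoly : ∀ {s} (adj : Fin s → Fin s → Bool) → Poly (f (graphComplex adj) 0)
SymEdgePoly adj = Psub (graphComplex adj) 1

cycleAdj : ∀ s → Fin s → Fin s → Bool
cycleAdj s i j = adj1 (toℕ i) (toℕ j) ∨ adj1 (toℕ j) (toℕ i)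
  where
  adj1 : ℕ → ℕ → Bool
  adj1 a b = (b ≡ᵇ suc a) ∨ ((a ≡ᵇ 0) ∧ (b ≡ᵇ ℕ.pred s))

-- facet-ridge graph of K (facets = d-faces): adjacent iff sharing a (d-1)-face
facetRidgeAdj : ∀ {n} (K : Complex n) → (d : ℕ) → Fin (f K d) → Fin (f K d) → Bool
facetRidgeAdj K d a b = ∣ jFace K d a ∩ jFace K d b ∣ ≡ᵇ d

record IsPseudomanifoldWithoutBoundary {n} (K : Complex n) (d : ℕ) : Set where
  field
    simplicial  : IsSimplicialComplex K
    hasFacet    : Σ (Subset n) λ σ → (K σ ≡ true) × (∣ σ ∣ ≡ suc d)
    dimBound    : ∀ σ → K σ ≡ true → ∣ σ ∣ ℕ.≤ suc d
    pure        : ∀ σ → K σ ≡ true →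
                  Σ (Subset n) λ τ → (K τ ≡ true) × (∣ τ ∣ ≡ suc d) × ((σ ⊆ᵇ τ) ≡ true)
    twoFacets   : ∀ ρ → K ρ ≡ true → ∣ ρ ∣ ≡ d →
                  length (filterᵇ (λ τ → ρ ⊆ᵇ τ) (faces K d)) ≡ 2
    strongConn  : ∀ a b → Star (λ x y → facetRidgeAdj K d x y ≡ true) a b

-- H_d(K;ℤ) = ker ∂_d (no (d+1)-faces) is isomorphic to ℤ, i.e. infinite cyclic
IsCycle : ∀ {n} (K : Complex n) (d : ℕ) → (Fin (f K d) → ℤ) → Set
IsCycle K d z = ∀ r → ℤ.+0 ≡ Σℤ (λ c → ∂ K d r c ℤ.* z c)
  where
  Σℤ : (Fin (f K d) → ℤ) → ℤ
  Σℤ g = List.foldr ℤ._+_ (+ 0) (List.map g (allFin (f K d)))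

TopHomologyIsℤ : ∀ {n} (K : Complex n) (d : ℕ) → Set
TopHomologyIsℤ K d =
  Σ (Fin (f K d) → ℤ) λ z → IsCycle K d z × (¬ (∀ c → z c ≡ + 0)) ×
    (∀ w → IsCycle K d w → Σ ℤ λ k → ∀ c → w c ≡ k ℤ.* z c)

record IsOrientablePseudomanifoldWithoutBoundary {n} (K : Complex n) (d : ℕ) : Set where
  field
    pseudo     : IsPseudomanifoldWithoutBoundary K d
    orientable : TopHomologyIsℤ K d

{-# OPTIONS --safe #-}

-- For a cycle z generating the top homology all |z_a| agree, so the signs of
-- the z_a turn every row of ∂_d into ± (e_a - e_b), where a and b are the two
-- facets containing the ridge: up to signs, ∂_d is the transpose of the
-- incidence matrix of the facet-ridge graph.  This is (2), with a diagonal
-- matrix of signs.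
--
-- For (1), let V be the matrix ∂_d with its columns so oriented, and let W be
-- the vertex-edge incidence matrix of the cycle on s edges, its columns
-- oriented along the cycle.  Seen from the columns, W too is the transposed
-- incidence matrix of a connected graph (again a cycle).  Summing rows along
-- paths expresses every difference e_a - e_b, and hence every row of the other
-- matrix, as an integer combination of rows: V = M W and W = N V.  The map
-- (w , y) ↦ (M w + y , w - N (M w + y)) is unimodular and sends the column
-- (W_i , 0) to (V_i , 0).
module Submission where

open import Defs
open import Data.Nat as ℕ using (ℕ; zero; suc; _≤_; z≤n; s≤s; _≡ᵇ_)
import Data.Nat.Properties as ℕ
open import Data.Integer using (ℤ; +_; -[1+_]; -_; _+_; _*_; _-_; 0ℤ; 1ℤ; -1ℤ; ∣_∣)
open import Data.Integer.Properties hiding (_≟_)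
open import Data.Integer.Tactic.RingSolver using (solve-∀)
open import Data.Rational as ℚ using (ℚ; 0ℚ; 1ℚ)
import Data.Rational.Properties as ℚ
open import Data.Rational.Unnormalised as ℚᵘ using (mkℚᵘ; *≡*)
import Data.Rational.Unnormalised.Properties as ℚᵘ
open import Data.Fin
  using (Fin; zero; suc; toℕ; fromℕ; fromℕ<; inject₁; inject≤; lower₁; cast; punchIn; punchOut; splitAt; join; _↑ˡ_; _≟_)
open import Data.Fin.Properties hiding (_≟_)
open import Data.Fin.Induction using (<-weakInduction)
open import Data.Fin.Subset as Subset using (Subset; ⊥; ⁅_⁆; _∪_; _∩_)
open import Data.Fin.Subset.Properties using (x∈⁅x⁆; x∈⁅y⁆⇒x≡y; ∣⁅x⁆∣≡1; ∪-identityˡ; ∪-identityʳ; ∣p∩q∣≤∣p∣; ∩-idem)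
open import Data.Vec as Vec using ([]; _∷_)
open import Data.Vec.Properties using (lookup⇒[]=; []=⇒lookup; lookup-zipWith)
open import Data.Vec.Functional using (updateAt)
open import Data.Vec.Functional.Properties using (updateAt-updates; updateAt-minimal)
open import Data.List as List using (List; []; _∷_; _++_; filterᵇ; length; lookup; allFin; tabulate)
open import Data.List.Properties using (filter-++; map-tabulate; length-tabulate)
open import Data.List.Membership.Propositional using (_∈_)
open import Data.List.Membership.Propositional.Properties
  using (∈-allFin; ∈-map⁺; ∈-map⁻; ∈-++⁺ˡ; ∈-++⁺ʳ; ∈-filter⁺; ∈-filter⁻; ∈-lookup)
open import Data.List.Relation.Unary.Any using (here; there; index)
open import Data.List.Relation.Unary.Any.Properties using (lookup-index)
open import Data.List.Relation.Unary.All as All using ([])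
open import Data.List.Relation.Unary.AllPairs using ([]; _∷_)
open import Data.List.Relation.Unary.Unique.Propositional using (Unique)
import Data.List.Relation.Unary.Unique.Propositional.Properties as Unique
open import Data.Maybe as Maybe using (just; nothing; maybe)
open import Data.Bool using (Bool; true; false; if_then_else_; not; _∧_; _∨_; T?)
open import Data.Bool.Properties using (∧-zeroʳ; ∨-zeroʳ; T-≡)
open import Data.Product as Product using (Σ; ∃; ∃₂; _×_; _,_; proj₁; proj₂)
open import Data.Sum as Sum using (_⊎_; inj₁; inj₂; [_,_]′)
open import Data.Sum.Properties using (swap-involutive)
open import Function using (_∘_; id; const)
open import Function.Bundles using (_⇔_; mk⇔; Equivalence)
open import Relation.Nullary using (¬_; yes; no; does; contradiction)
open import Relation.Nullary.Decidable using (dec-true; dec-false)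
open import Relation.Binary.PropositionalEquality
open import Relation.Binary.Construct.Closure.ReflexiveTransitive as Star using (Star; ε; _◅_; _◅◅_; reverse)
open import Algebra.Bundles using (CommutativeMonoid; CommutativeRing)
import Algebra.Properties.CommutativeMonoid.Sum as CommutativeMonoidSum
open import Algebra.Properties.CommutativeMonoid.Sum +-0-commutativeMonoid using (sum-remove)
open import Algebra.Properties.Semiring.Sum +-*-semiring
  using (sum; sum-cong-≗; ∑-distrib-+; ∑-comm; *-distribˡ-sum; *-distribʳ-sum)
import Algebra.Properties.Semiring.Sum (CommutativeRing.semiring ℚ.+-*-commutativeRing) as ∑ℚ

-- The moduli agree because a ridge lies in exactly two facets: each equation of the cycle condition
-- has two terms with coefficients ±1, and strong connectivity spreads the equality of moduli to all
-- facets. Every polytope here is the hull of points and their negatives, so the signs of the points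
-- are free. In (1) the signs of z multiply points and disappear; in (2) the same signs multiply
-- coordinates, and a matrix has to undo them. The obstacle in (1) is that V has a row for every
-- ridge and W one for every vertex of the cycle. M and N are rectangular, and N M need not be the
-- identity; only N M W = W is known. Giving the ambient space both sets of coordinates lets M and N
-- act as shears, whose determinant is 1 whatever their entries, so that neither ranks nor lattice
-- bases have to be compared. Determinants are cofactor expansions along the top row, and the rules
-- for row operations are derived from that.

-- Finite sums with at most one nonzero term

module _ {c ℓ} (M : CommutativeMonoid c ℓ) where
  open CommutativeMonoid M using (Carrier; ∙-congˡ; identityʳ) renaming (_≈_ to _≃_; trans to ≃-trans; ε to 0#)
  open CommutativeMonoidSum M using (sum-cong-≋; sum-replicate-zero) renaming (sum to ∑; sum-remove to ∑-remove)

  sum-zero : ∀ {n} (g : Fin n → Carrier) → (∀ i → g i ≃ 0#) → ∑ g ≃ 0#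
  sum-zero {n} g g≃0 = ≃-trans (sum-cong-≋ g≃0) (sum-replicate-zero n)

  sum-single : ∀ {n} (a : Fin n) (g : Fin n → Carrier) → (∀ i → i ≢ a → g i ≃ 0#) → ∑ g ≃ g a
  sum-single {suc n} a g g≃0 =
    ≃-trans (∑-remove {i = a} g)
      (≃-trans (∙-congˡ (sum-zero _ (λ j → g≃0 (punchIn a j) (punchInᵢ≢i a j)))) (identityʳ _))

sumℤ-zero : ∀ {n} (g : Fin n → ℤ) → (∀ i → g i ≡ 0ℤ) → sum g ≡ 0ℤ
sumℤ-zero = sum-zero +-0-commutativeMonoid

sumℤ-single : ∀ {n} (a : Fin n) (g : Fin n → ℤ) → (∀ i → i ≢ a → g i ≡ 0ℤ) → sum g ≡ g a
sumℤ-single = sum-single +-0-commutativeMonoid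

-- Determinants

Matrix : ℕ → Set
Matrix m = Fin m → Fin m → ℤ

minor : ∀ {m} → Matrix (suc m) → Fin (suc m) → Matrix m
minor A j r c = A (suc r) (punchIn j c)

laplaceTerm : ∀ {m} → Matrix (suc m) → Fin (suc m) → ℤ
laplaceTerm A j = sign (toℕ j) * A zero j * det (minor A j)

partialLaplace : ∀ m → Matrix (suc m) → ∀ k → (Fin k → Fin (suc m)) → ℤ
partialLaplace m A zero    col = + 0
partialLaplace m A (suc k) col = laplaceTerm A (col zero) + partialLaplace m A k (col ∘ suc)

-- The sum inside `det` is a local function without an accessible name.  The
-- underscore in the type of `go≡` is solved to it: `det` of a matrix of size
-- n + 2 unfolds to two terms and that function applied to n, and the
-- `with`-abstraction separates this n from the size of the matrix.
mutual
  go≡ : ∀ m (A : Matrix (suc m)) k col → _ ≡ partialLaplace m A k col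

  tail≡ : ∀ n (A : Matrix (suc (suc n))) → _ ≡ partialLaplace (suc n) A n (λ i → suc (suc i))

  det≡partialLaplace : ∀ {m} (A : Matrix (suc m)) → det A ≡ partialLaplace m A (suc m) id
  det≡partialLaplace {zero}  A = refl
  det≡partialLaplace {suc n} A =
    cong (λ z → laplaceTerm A zero + (laplaceTerm A (suc zero) + z)) (tail≡ n A)

  tail≡ n A with suc n | (λ (i : Fin n) → Fin.suc (Fin.suc i))
  ... | m | col = go≡ m A n col

  go≡ m A zero    col = refl
  go≡ m A (suc k) col = cong (λ z → laplaceTerm A (col zero) + z) (go≡ m A k (col ∘ suc))

partialLaplace≡sum : ∀ m (A : Matrix (suc m)) k col → partialLaplace m A k col ≡ sum (laplaceTerm A ∘ col)
partialLaplace≡sum m A zero    col = refl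
partialLaplace≡sum m A (suc k) col = cong (λ z → laplaceTerm A (col zero) + z) (partialLaplace≡sum m A k (col ∘ suc))

det-laplace : ∀ {m} (A : Matrix (suc m)) → det A ≡ sum (laplaceTerm A)
det-laplace {m} A = trans (det≡partialLaplace A) (partialLaplace≡sum m A (suc m) id)

det-cong : ∀ {m} (A B : Matrix m) → (∀ i j → A i j ≡ B i j) → det A ≡ det B
det-cong {zero}  A B A≡B = refl
det-cong {suc m} A B A≡B = begin
  det A                ≡⟨ det-laplace A ⟩
  sum (laplaceTerm A)  ≡⟨ sum-cong-≗ (λ j → cong₂ (λ a d → sign (toℕ j) * a * d) (A≡B zero j)
                            (det-cong (minor A j) (minor B j) (λ r c → A≡B (suc r) (punchIn j c)))) ⟩
  sum (laplaceTerm B)  ≡⟨ det-laplace B ⟨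
  det B                ∎
  where open ≡-Reasoning

-- In each term of the expansion along the top row only one factor varies: the entry if `i` is the
-- top row, otherwise the minor, to which induction applies.
det-row-linear : ∀ {m} (i : Fin m) (A B C : Matrix m) t →
  (∀ k → k ≢ i → ∀ c → B k c ≡ A k c) → (∀ k → k ≢ i → ∀ c → C k c ≡ A k c) →
  (∀ c → A i c ≡ B i c + t * C i c) → det A ≡ det B + t * det C
det-row-linear {suc m} i A B C t B≡A C≡A Ai = begin
  det A                                                  ≡⟨ det-laplace A ⟩
  sum (laplaceTerm A)                                    ≡⟨ sum-cong-≗ (termwise i B≡A C≡A Ai) ⟩
  sum (λ j → laplaceTerm B j + t * laplaceTerm C j)      ≡⟨ ∑-distrib-+ (laplaceTerm B) (λ j → t * laplaceTerm C j) ⟩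
  sum (laplaceTerm B) + sum (λ j → t * laplaceTerm C j)  ≡⟨ cong (λ z → sum (laplaceTerm B) + z) (*-distribˡ-sum t (laplaceTerm C)) ⟨
  sum (laplaceTerm B) + t * sum (laplaceTerm C)          ≡⟨ cong₂ (λ x y → x + t * y) (det-laplace B) (det-laplace C) ⟨
  det B + t * det C                                      ∎
  where
  open ≡-Reasoning
  distrib-entry : ∀ s b t c d → s * (b + t * c) * d ≡ s * b * d + t * (s * c * d)
  distrib-entry = solve-∀
  distrib-minor : ∀ s a t d e → s * a * (d + t * e) ≡ s * a * d + t * (s * a * e)
  distrib-minor = solve-∀
  termwise : ∀ i → (∀ k → k ≢ i → ∀ c → B k c ≡ A k c) → (∀ k → k ≢ i → ∀ c → C k c ≡ A k c) →
    (∀ c → A i c ≡ B i c + t * C i c) → ∀ j → laplaceTerm A j ≡ laplaceTerm B j + t * laplaceTerm C j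
  termwise zero B≡A C≡A Ai j
    rewrite Ai j
          | det-cong (minor B j) (minor A j) (λ r c → B≡A (suc r) (λ ()) (punchIn j c))
          | det-cong (minor C j) (minor A j) (λ r c → C≡A (suc r) (λ ()) (punchIn j c))
    = distrib-entry (sign (toℕ j)) (B zero j) t (C zero j) (det (minor A j))
  termwise (suc i) B≡A C≡A Ai j
    rewrite B≡A zero (λ ()) j | C≡A zero (λ ()) j
          | det-row-linear i (minor A j) (minor B j) (minor C j) t
              (λ k k≢i c → B≡A (suc k) (k≢i ∘ suc-injective) (punchIn j c))
              (λ k k≢i c → C≡A (suc k) (k≢i ∘ suc-injective) (punchIn j c))
              (λ c → Ai (punchIn j c))
    = distrib-minor (sign (toℕ j)) (A zero j) t (det (minor B j)) (det (minor C j))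

-- Pairs up (j, k) and (k + 1, j) for j ≤ k: these are the two orders in which
-- two columns can be deleted.
sum-pairs-cancel : ∀ n (G H : Fin (suc n) → Fin n → ℤ) →
  (∀ j k → toℕ j ≤ toℕ k → G (inject₁ j) k + H (suc k) j ≡ 0ℤ) →
  (∀ j k → toℕ j ≤ toℕ k → G (suc k) j + H (inject₁ j) k ≡ 0ℤ) →
  sum (λ j → sum (G j)) + sum (λ j → sum (H j)) ≡ 0ℤ
sum-pairs-cancel zero    G H GH HG = refl
sum-pairs-cancel (suc n) G H GH HG = begin
  (a + sum (λ j → G (suc j) zero + sum (G₊ j))) + (a′ + sum (λ j → H (suc j) zero + sum (H₊ j)))
    ≡⟨ cong₂ (λ x y → (a + x) + (a′ + y)) (∑-distrib-+ (λ j → G (suc j) zero) (sum ∘ G₊))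
         (∑-distrib-+ (λ j → H (suc j) zero) (sum ∘ H₊)) ⟩
  (a + (b + s)) + (a′ + (b′ + s′))
    ≡⟨ regroup a b s a′ b′ s′ ⟩
  (a + b′) + (b + a′) + (s + s′)
    ≡⟨ cong₂ _+_ (cong₂ _+_ a+b′≡0 b+a′≡0)
         (sum-pairs-cancel n G₊ H₊ (λ j k j≤k → GH (suc j) (suc k) (s≤s j≤k)) (λ j k j≤k → HG (suc j) (suc k) (s≤s j≤k))) ⟩
  0ℤ ∎
  where
  open ≡-Reasoning
  G₊ H₊ : Fin (suc n) → Fin n → ℤ
  G₊ j k = G (suc j) (suc k)
  H₊ j k = H (suc j) (suc k)
  a  = sum (G zero)
  a′ = sum (H zero)
  b  = sum (λ j → G (suc j) zero)
  b′ = sum (λ j → H (suc j) zero)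
  s  = sum (λ j → sum (G₊ j))
  s′ = sum (λ j → sum (H₊ j))
  regroup : ∀ a b s a′ b′ s′ → (a + (b + s)) + (a′ + (b′ + s′)) ≡ (a + b′) + (b + a′) + (s + s′)
  regroup = solve-∀
  a+b′≡0 : a + b′ ≡ 0ℤ
  a+b′≡0 = trans (sym (∑-distrib-+ (G zero) (λ k → H (suc k) zero))) (sumℤ-zero _ (λ k → GH zero k z≤n))
  b+a′≡0 : b + a′ ≡ 0ℤ
  b+a′≡0 = trans (sym (∑-distrib-+ (λ j → G (suc j) zero) (H zero))) (sumℤ-zero _ (λ k → HG zero k z≤n))

punchIn-inject₁ : ∀ {n} (j k : Fin n) → toℕ j ≤ toℕ k → punchIn (inject₁ j) k ≡ suc k
punchIn-inject₁ zero    k       j≤k       = refl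
punchIn-inject₁ (suc j) (suc k) (s≤s j≤k) = cong suc (punchIn-inject₁ j k j≤k)

punchIn-suc : ∀ {n} (j k : Fin n) → toℕ j ≤ toℕ k → punchIn (suc k) j ≡ inject₁ j
punchIn-suc zero    k       j≤k       = refl
punchIn-suc (suc j) (suc k) (s≤s j≤k) = cong suc (punchIn-suc j k j≤k)

-- Deleting two columns in either order leaves the same columns, so the two double minors coincide.
-- This is the identity between coface maps of simplices.
punchIn-comm : ∀ {n} (j k : Fin (suc n)) → toℕ j ≤ toℕ k → ∀ c →
  punchIn (inject₁ j) (punchIn k c) ≡ punchIn (suc k) (punchIn j c)
punchIn-comm zero    k       j≤k       c       = refl
punchIn-comm (suc j) (suc k) (s≤s j≤k) zero    = refl
punchIn-comm (suc j) (suc k) (s≤s j≤k) (suc c) = cong suc (punchIn-comm j k j≤k c)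

swapTopRows : ∀ {m} → Matrix (suc (suc m)) → Matrix (suc (suc m))
swapTopRows A zero          = A (suc zero)
swapTopRows A (suc zero)    = A zero
swapTopRows A (suc (suc r)) = A (suc (suc r))

private
  doubleTerm : ∀ {m} → Matrix (suc (suc m)) → Fin (suc (suc m)) → Fin (suc m) → ℤ
  doubleTerm A j k = sign (toℕ j) * A zero j * laplaceTerm (minor A j) k

  det-doubleLaplace : ∀ {m} (A : Matrix (suc (suc m))) → det A ≡ sum (λ j → sum (doubleTerm A j))
  det-doubleLaplace A = trans (det-laplace A) (sum-cong-≗ λ j →
    trans (cong (λ d → sign (toℕ j) * A zero j * d) (det-laplace (minor A j)))
          (*-distribˡ-sum (sign (toℕ j) * A zero j) (laplaceTerm (minor A j))))

  -- Both terms use the same two columns and the same double minor. Deleting the left column first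
  -- lowers the position of the right one by one, which gives the opposite sign. The relation
  -- between `A` and `B` is stated symmetrically, so that the lemma also applies with the two
  -- exchanged.
  doubleTerm-cancel : ∀ {m} (A B : Matrix (suc (suc m))) →
    (∀ c → A zero c ≡ B (suc zero) c) → (∀ c → A (suc zero) c ≡ B zero c) →
    (∀ r c → A (suc (suc r)) c ≡ B (suc (suc r)) c) →
    ∀ j k → toℕ j ≤ toℕ k → doubleTerm A (inject₁ j) k + doubleTerm B (suc k) j ≡ 0ℤ
  doubleTerm-cancel A B A₀ A₁ A₊ j k j≤k
    rewrite toℕ-inject₁ j | punchIn-inject₁ j k j≤k | punchIn-suc j k j≤k
          | A₀ (inject₁ j) | A₁ (suc k)
          | det-cong (minor (minor A (inject₁ j)) k) (minor (minor B (suc k)) j)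
              (λ r c → trans (A₊ r _) (cong (B (suc (suc r))) (punchIn-comm j k j≤k c)))
    = cancel (sign (toℕ j)) (B (suc zero) (inject₁ j)) (sign (toℕ k)) (B zero (suc k)) _
    where
    cancel : ∀ s a t b d → s * a * (t * b * d) + - t * b * (s * a * d) ≡ 0ℤ
    cancel = solve-∀

det-swapTopRows : ∀ {m} (A : Matrix (suc (suc m))) → det A ≡ - det (swapTopRows A)
det-swapTopRows {m} A = begin
  det A                                          ≡⟨ x≡x+y-y (det A) (det B) ⟩
  det A + det B + - det B                        ≡⟨ cong (_- det B) (cong₂ _+_ (det-doubleLaplace A) (det-doubleLaplace B)) ⟩
  sum (λ j → sum (doubleTerm A j)) + sum (λ j → sum (doubleTerm B j)) + - det B
    ≡⟨ cong (_- det B) (sum-pairs-cancel (suc m) (doubleTerm A) (doubleTerm B)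
         (doubleTerm-cancel A B (λ _ → refl) (λ _ → refl) (λ _ _ → refl))
         (λ j k j≤k → trans (+-comm (doubleTerm A (suc k) j) _)
           (doubleTerm-cancel B A (λ _ → refl) (λ _ → refl) (λ _ _ → refl) j k j≤k))) ⟩
  0ℤ + - det B                                   ≡⟨ +-identityˡ _ ⟩
  - det B                                        ∎
  where
  open ≡-Reasoning
  B = swapTopRows A
  x≡x+y-y : ∀ x y → x ≡ x + y + - y
  x≡x+y-y = solve-∀

private
  i≡-i⇒i≡0 : ∀ i → i ≡ - i → i ≡ 0ℤ
  i≡-i⇒i≡0 (+ zero) _ = refl

  det-zero-minors : ∀ {m} (A : Matrix (suc m)) → (∀ j → det (minor A j) ≡ 0ℤ) → det A ≡ 0ℤ
  det-zero-minors A minors≡0 = trans (det-laplace A) (sumℤ-zero _ (λ j →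
    trans (cong (λ d → sign (toℕ j) * A zero j * d) (minors≡0 j)) (*-zeroʳ (sign (toℕ j) * A zero j))))

  -- If the two top rows agree, swapping them gives det A = - det A, and ℤ has no 2-torsion. If the
  -- repetition is lower, the swap moves the top row into all minors, where it is again a repeated
  -- top row.
  det-topRow-repeated : ∀ {m} (A : Matrix (suc m)) j → (∀ c → A zero c ≡ A (suc j) c) → det A ≡ 0ℤ

det-alternating : ∀ {m} (A : Matrix m) i j → i ≢ j → (∀ c → A i c ≡ A j c) → det A ≡ 0ℤ
det-alternating A zero    zero    i≢j Ai≡Aj = contradiction refl i≢j
det-alternating A zero    (suc j) i≢j Ai≡Aj = det-topRow-repeated A j Ai≡Aj
det-alternating A (suc i) zero    i≢j Ai≡Aj = det-topRow-repeated A i (sym ∘ Ai≡Aj)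
det-alternating A (suc i) (suc j) i≢j Ai≡Aj = det-zero-minors A λ k →
  det-alternating (minor A k) i j (i≢j ∘ cong suc) (λ c → Ai≡Aj (punchIn k c))

det-topRow-repeated A zero A₀≡A₁ = i≡-i⇒i≡0 (det A) (trans (det-swapTopRows A)
  (cong -_ (det-cong (swapTopRows A) A λ { zero c → sym (A₀≡A₁ c) ; (suc zero) c → A₀≡A₁ c ; (suc (suc r)) c → refl })))
det-topRow-repeated A (suc j) A₀≡Aj = trans (det-swapTopRows A)
  (cong -_ (det-zero-minors (swapTopRows A) λ k →
    det-topRow-repeated (minor (swapTopRows A) k) j (λ c → A₀≡Aj (punchIn k c))))

-- Linearity in row `i` splits off one added row at a time, as a multiple of the determinant of `C`:
-- either the multiple is zero or `C` has two equal rows. The alternative `c k ≡ 0ℤ` lets a caller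
-- supply coefficients for all rows, row `i` included.
det-addRows : ∀ {m n} (i : Fin m) (A B : Matrix m) (c : Fin n → ℤ) (h : Fin n → Fin m) →
  (∀ k → c k ≡ 0ℤ ⊎ i ≢ h k) → (∀ k → k ≢ i → ∀ x → B k x ≡ A k x) →
  (∀ x → B i x ≡ A i x + sum (λ k → c k * A (h k) x)) → det B ≡ det A
det-addRows {n = zero} i A B c h c≡0⊎ B≡A Bi = det-cong B A B≗A
  where
  B≗A : ∀ k x → B k x ≡ A k x
  B≗A k x with k ≟ i
  ... | yes refl = trans (Bi x) (+-identityʳ (A i x))
  ... | no k≢i   = B≡A k k≢i x
det-addRows {m} {suc n} i A B c h c≡0⊎ B≡A Bi = begin
  det B                    ≡⟨ det-row-linear i B A′ C (c zero)
                                (λ k k≢i x → trans (cong (λ row → row x) (updateAt-minimal k i A k≢i)) (sym (B≡A k k≢i x)))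
                                (λ k k≢i x → trans (cong (λ row → row x) (updateAt-minimal k i A k≢i)) (sym (B≡A k k≢i x)))
                                Bi′ ⟩
  det A′ + c zero * det C  ≡⟨ cong₂ _+_ (det-addRows i A A′ (c ∘ suc) (h ∘ suc) (c≡0⊎ ∘ suc)
                                (λ k k≢i x → cong (λ row → row x) (updateAt-minimal k i A k≢i))
                                (λ x → cong (λ row → row x) (updateAt-updates i A)))
                                (c*detC≡0 (c≡0⊎ zero)) ⟩
  det A + 0ℤ               ≡⟨ +-identityʳ (det A) ⟩
  det A                    ∎
  where
  open ≡-Reasoning
  A′ C : Matrix m
  A′ = updateAt A i (λ row x → row x + sum (λ k → c (suc k) * A (h (suc k)) x))
  C = updateAt A i (const (A (h zero)))
  reorder : ∀ a b d → a + (b + d) ≡ (a + d) + b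
  reorder = solve-∀
  Bi′ : ∀ x → B i x ≡ A′ i x + c zero * C i x
  Bi′ x = trans (Bi x) (trans (reorder (A i x) _ _)
    (cong₂ (λ p q → p + c zero * q) (cong (λ row → row x) (sym (updateAt-updates i A)))
                                    (cong (λ row → row x) (sym (updateAt-updates i A)))))
  c*detC≡0 : c zero ≡ 0ℤ ⊎ i ≢ h zero → c zero * det C ≡ 0ℤ
  c*detC≡0 (inj₁ c≡0) = trans (cong (_* det C) c≡0) (*-zeroˡ (det C))
  c*detC≡0 (inj₂ i≢h) = trans (cong (c zero *_) (det-alternating C i (h zero) i≢h λ x →
    trans (cong (λ row → row x) (updateAt-updates i A))
          (cong (λ row → row x) (sym (updateAt-minimal (h zero) i A (i≢h ∘ sym)))))) (*-zeroʳ (c zero))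

-- Rows marked by `S` receive combinations of unmarked rows, and unmarked rows never change. The
-- rows can therefore be replaced one after another, each time adding rows that are still those of
-- `A`.
det-shear : ∀ {m} (S : Fin m → Bool) (A B C : Matrix m) →
  (∀ i k → C i k ≡ 0ℤ ⊎ (S i ≡ true × S k ≡ false)) →
  (∀ i x → B i x ≡ A i x + sum (λ k → C i k * A k x)) → det B ≡ det A
det-shear {m} S A B C supp B≡ = begin
  det B      ≡⟨ det-cong (D m) B (λ i x → D-< m i x (toℕ<n i)) ⟨
  det (D m)  ≡⟨ D-const m ⟩
  det A      ∎
  where
  open ≡-Reasoning
  -- The stage at which the rows before `t` have been replaced: stage 0 is `A`, stage `m` is `B`.
  D : ℕ → Matrix m
  D t i x = if does (toℕ i ℕ.<? t) then B i x else A i x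
  D-< : ∀ t i x → toℕ i ℕ.< t → D t i x ≡ B i x
  D-< t i x i<t rewrite dec-true (toℕ i ℕ.<? t) i<t = refl
  D-≮ : ∀ t i x → ¬ (toℕ i ℕ.< t) → D t i x ≡ A i x
  D-≮ t i x i≮t rewrite dec-false (toℕ i ℕ.<? t) i≮t = refl
  fixed : ∀ k x → S k ≡ false → B k x ≡ A k x
  fixed k x Sk≡false = trans (B≡ k x) (trans (cong (λ z → A k x + z) (sumℤ-zero _ zeros)) (+-identityʳ (A k x)))
    where
    zeros : ∀ l → C k l * A l x ≡ 0ℤ
    zeros l with supp k l
    ... | inj₁ C≡0 = trans (cong (_* A l x) C≡0) (*-zeroˡ (A l x))
    ... | inj₂ (Sk≡true , _) with () ← trans (sym Sk≡true) Sk≡false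
  D-fixed : ∀ t k x → S k ≡ false → D t k x ≡ A k x
  D-fixed t k x Sk with toℕ k ℕ.<? t
  ... | yes k<t = trans (D-< t k x k<t) (fixed k x Sk)
  ... | no k≮t  = D-≮ t k x k≮t
  D-step : ∀ t k → toℕ k ≢ t → ∀ x → D (suc t) k x ≡ D t k x
  D-step t k k≢t x with toℕ k ℕ.<? t
  ... | yes k<t = trans (D-< (suc t) k x (ℕ.m<n⇒m<1+n k<t)) (sym (D-< t k x k<t))
  ... | no k≮t  = trans (D-≮ (suc t) k x (λ k<1+t → k≮t (ℕ.≤∧≢⇒< (ℕ.s≤s⁻¹ k<1+t) k≢t))) (sym (D-≮ t k x k≮t))
  D-const : ∀ t → det (D t) ≡ det A
  D-const zero = det-cong (D zero) A (λ i x → D-≮ zero i x λ ())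
  D-const (suc t) with t ℕ.<? m
  ... | no t≮m = trans (det-cong (D (suc t)) (D t) λ k → D-step t k λ { refl → t≮m (toℕ<n k) }) (D-const t)
  ... | yes t<m = trans (det-addRows i (D t) (D (suc t)) (C i) id support
                    (λ k k≢i → D-step t k (λ k≡t → k≢i (toℕ-injective (trans k≡t (sym i≡t))))) row-i) (D-const t)
    where
    i = fromℕ< t<m
    i≡t : toℕ i ≡ t
    i≡t = toℕ-fromℕ< t<m
    support : ∀ k → C i k ≡ 0ℤ ⊎ i ≢ k
    support k with supp i k
    ... | inj₁ C≡0 = inj₁ C≡0
    ... | inj₂ (Si , Sk) = inj₂ λ i≡k → contradiction (trans (sym Si) (trans (cong S i≡k) Sk)) λ ()
    summand : ∀ x k → C i k * A k x ≡ C i k * D t k x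
    summand x k with supp i k
    ... | inj₁ C≡0 = trans (cong (_* A k x) C≡0) (sym (cong (_* D t k x) C≡0))
    ... | inj₂ (_ , Sk) = cong (C i k *_) (sym (D-fixed t k x Sk))
    row-i : ∀ x → D (suc t) i x ≡ D t i x + sum (λ k → C i k * D t k x)
    row-i x = begin
      D (suc t) i x                              ≡⟨ D-< (suc t) i x (s≤s (ℕ.≤-reflexive i≡t)) ⟩
      B i x                                      ≡⟨ B≡ i x ⟩
      A i x + sum (λ k → C i k * A k x)          ≡⟨ cong₂ _+_ (sym (D-≮ t i x (ℕ.<-irrefl i≡t))) (sum-cong-≗ (summand x)) ⟩
      D t i x + sum (λ k → C i k * D t k x)      ∎

∣sign∣≡1 : ∀ k → ∣ sign k ∣ ≡ 1
∣sign∣≡1 zero    = refl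
∣sign∣≡1 (suc k) = trans (∣-i∣≡∣i∣ (sign k)) (∣sign∣≡1 k)

-- The top row leaves one term of the expansion, and `punchOut` relabels the other columns into an
-- injection for its minor. Absolute values avoid the sign of the permutation.
det-monomial : ∀ {m} (A : Matrix m) (π : Fin m → Fin m) → (∀ i j → π i ≡ π j → i ≡ j) →
  (∀ i → ∣ A i (π i) ∣ ≡ 1) → (∀ i c → c ≢ π i → A i c ≡ 0ℤ) → ∣ det A ∣ ≡ 1
det-monomial {zero}  A π π-inj unit zeros = refl
det-monomial {suc m} A π π-inj unit zeros = begin
  ∣ det A ∣                                                    ≡⟨ cong ∣_∣ (det-laplace A) ⟩
  ∣ sum (laplaceTerm A) ∣                                      ≡⟨ cong ∣_∣ (sumℤ-single (π zero) (laplaceTerm A) term≡0) ⟩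
  ∣ sign p * A zero (π zero) * det (minor A (π zero)) ∣        ≡⟨ abs-* (sign p * A zero (π zero)) _ ⟩
  ∣ sign p * A zero (π zero) ∣ ℕ.* ∣ det (minor A (π zero)) ∣  ≡⟨ cong₂ ℕ._*_ (abs-* (sign p) _) detMinor ⟩
  ∣ sign p ∣ ℕ.* ∣ A zero (π zero) ∣ ℕ.* 1                     ≡⟨ cong₂ (λ x y → x ℕ.* y ℕ.* 1) (∣sign∣≡1 p) (unit zero) ⟩
  1                                                            ∎
  where
  open ≡-Reasoning
  p = toℕ (π zero)
  term≡0 : ∀ c → c ≢ π zero → laplaceTerm A c ≡ 0ℤ
  term≡0 c c≢π rewrite zeros zero c c≢π | *-zeroʳ (sign (toℕ c)) = *-zeroˡ (det (minor A c))
  π0≢ : ∀ r → π zero ≢ π (suc r)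
  π0≢ r π≡ with () ← π-inj zero (suc r) π≡
  detMinor : ∣ det (minor A (π zero)) ∣ ≡ 1
  detMinor = det-monomial (minor A (π zero)) (λ r → punchOut (π0≢ r))
    (λ i j eq → suc-injective (π-inj (suc i) (suc j) (punchOut-injective (π0≢ i) (π0≢ j) eq)))
    (λ i → trans (cong (λ c → ∣ A (suc i) c ∣) (punchIn-punchOut (π0≢ i))) (unit (suc i)))
    (λ i c c≢ → zeros (suc i) (punchIn (π zero) c)
      (λ eq → c≢ (punchIn-injective (π zero) c _ (trans eq (sym (punchIn-punchOut (π0≢ i)))))))

δ : ∀ {n} → Fin n → Fin n → ℤ
δ i j = if does (i ≟ j) then 1ℤ else 0ℤ

δ-refl : ∀ {n} (i : Fin n) → δ i i ≡ 1ℤ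
δ-refl i rewrite dec-true (i ≟ i) refl = refl

δ-≢ : ∀ {n} {i j : Fin n} → i ≢ j → δ i j ≡ 0ℤ
δ-≢ {i = i} {j} i≢j rewrite dec-false (i ≟ j) i≢j = refl

sum-δˡ : ∀ {n} (a : Fin n) (g : Fin n → ℤ) → sum (λ i → g i * δ i a) ≡ g a
sum-δˡ a g = trans (sumℤ-single a _ λ i i≢a → trans (cong (g i *_) (δ-≢ i≢a)) (*-zeroʳ (g i)))
  (trans (cong (g a *_) (δ-refl a)) (*-identityʳ (g a)))

sum-δʳ : ∀ {n} (a : Fin n) (g : Fin n → ℤ) → sum (λ i → δ a i * g i) ≡ g a
sum-δʳ a g = trans (sumℤ-single a _ λ i i≢a → trans (cong (_* g i) (δ-≢ (i≢a ∘ sym))) (*-zeroˡ (g i)))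
  (trans (cong (_* g a) (δ-refl a)) (*-identityˡ (g a)))

sum-splitAt : ∀ m {n} (g : Fin m ⊎ Fin n → ℤ) → sum (g ∘ splitAt m) ≡ sum (g ∘ inj₁) + sum (g ∘ inj₂)
sum-splitAt zero    g = sym (+-identityˡ _)
sum-splitAt (suc m) g = trans (cong (λ z → g (inj₁ zero) + z) (sum-splitAt m (g ∘ Sum.map suc id)))
  (sym (+-assoc (g (inj₁ zero)) (sum (g ∘ inj₁ ∘ suc)) _))

sum-cast : ∀ {m n} (m≡n : m ≡ n) (g : Fin n → ℤ) → sum (g ∘ cast m≡n) ≡ sum g
sum-cast refl g = sum-cong-≗ (λ i → cong g (cast-is-id refl i))

-- Block matrices whose rows are split as r + b and whose columns as b + r.
module Blocks (r b : ℕ) where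

  rowBlock : Fin (r ℕ.+ b) → Fin r ⊎ Fin b
  rowBlock = splitAt r

  -- Padding places a polytope in the leading coordinates. The target occupies the first `r` rows
  -- and the source the first `b` columns, so the two splittings differ by a `cast`.
  colBlock : Fin (r ℕ.+ b) → Fin b ⊎ Fin r
  colBlock = splitAt b ∘ cast (ℕ.+-comm r b)

  colIndex : Fin b ⊎ Fin r → Fin (r ℕ.+ b)
  colIndex = cast (ℕ.+-comm b r) ∘ join b r

  colBlock-colIndex : ∀ x → colBlock (colIndex x) ≡ x
  colBlock-colIndex x = trans (cong (splitAt b) (cast-involutive (ℕ.+-comm r b) (ℕ.+-comm b r) (join b r x))) (splitAt-join b r x)

  colIndex-colBlock : ∀ c → colIndex (colBlock c) ≡ c
  colIndex-colBlock c = trans (cong (cast (ℕ.+-comm b r)) (join-splitAt b r (cast (ℕ.+-comm r b) c)))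
    (cast-involutive (ℕ.+-comm b r) (ℕ.+-comm r b) c)

  BlockMatrix : Set
  BlockMatrix = Fin r ⊎ Fin b → Fin b ⊎ Fin r → ℤ

  assemble : BlockMatrix → Matrix (r ℕ.+ b)
  assemble X i c = X (rowBlock i) (colBlock c)

  sum-colBlock : (g : Fin b ⊎ Fin r → ℤ) → sum (g ∘ colBlock) ≡ sum (g ∘ inj₁) + sum (g ∘ inj₂)
  sum-colBlock g = trans (sum-cast (ℕ.+-comm r b) (g ∘ splitAt b)) (sum-splitAt b g)

  module _ (M : Fin r → Fin b → ℤ) (N : Fin b → Fin r → ℤ) where

    -- The matrix of (w , y) ↦ (M w + y , w - N (M w + y)), a composition of
    -- two shears and a swap of the two blocks: it sends (w , 0) to (M w , 0)
    -- whenever N (M w) = w.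
    shearSwap : BlockMatrix
    shearSwap (inj₁ ρ) (inj₁ v) = M ρ v
    shearSwap (inj₁ ρ) (inj₂ σ) = δ ρ σ
    shearSwap (inj₂ v) (inj₁ x) = δ v x - sum (λ ρ → N v ρ * M ρ x)
    shearSwap (inj₂ v) (inj₂ σ) = - N v σ

    private
      -- Row operations undo the composition. Adding N times the upper block to the lower one gives
      -- `sheared`, with block rows (M , I) and (I , 0); subtracting M times the lower block from
      -- the upper one gives `swapped`, with (0 , I) and (I , 0).
      swapped sheared : BlockMatrix
      sheared (inj₁ ρ) c        = shearSwap (inj₁ ρ) c
      sheared (inj₂ v) (inj₁ x) = δ v x
      sheared (inj₂ v) (inj₂ σ) = 0ℤ
      swapped (inj₁ ρ) (inj₁ v) = 0ℤ
      swapped (inj₁ ρ) (inj₂ σ) = δ ρ σ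
      swapped (inj₂ v) c        = sheared (inj₂ v) c

      lowerCoeff upperCoeff : Fin r ⊎ Fin b → Fin r ⊎ Fin b → ℤ
      lowerCoeff (inj₂ v) (inj₁ ρ) = N v ρ
      lowerCoeff _        _        = 0ℤ
      upperCoeff (inj₁ ρ) (inj₂ v) = - M ρ v
      upperCoeff _        _        = 0ℤ

      isLower isUpper : Fin r ⊎ Fin b → Bool
      isLower (inj₁ _) = false
      isLower (inj₂ _) = true
      isUpper (inj₁ _) = true
      isUpper (inj₂ _) = false

      lowerSupport : ∀ x y → lowerCoeff x y ≡ 0ℤ ⊎ (isLower x ≡ true × isLower y ≡ false)
      lowerSupport (inj₁ _) _        = inj₁ refl
      lowerSupport (inj₂ _) (inj₁ _) = inj₂ (refl , refl)
      lowerSupport (inj₂ _) (inj₂ _) = inj₁ refl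

      upperSupport : ∀ x y → upperCoeff x y ≡ 0ℤ ⊎ (isUpper x ≡ true × isUpper y ≡ false)
      upperSupport (inj₁ _) (inj₁ _) = inj₁ refl
      upperSupport (inj₁ _) (inj₂ _) = inj₂ (refl , refl)
      upperSupport (inj₂ _) _        = inj₁ refl

      rowSum : (c : Fin r ⊎ Fin b → ℤ) (X : BlockMatrix) (y : Fin b ⊎ Fin r) → ℤ
      rowSum c X y = sum (λ ρ → c (inj₁ ρ) * X (inj₁ ρ) y) + sum (λ v → c (inj₂ v) * X (inj₂ v) y)

      zeros : ∀ {n} (g : Fin n → ℤ) → sum (λ i → 0ℤ * g i) ≡ 0ℤ
      zeros g = sumℤ-zero _ (λ i → *-zeroˡ (g i))

      lowerShear : ∀ x y → sheared x y ≡ shearSwap x y + rowSum (lowerCoeff x) shearSwap y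
      lowerShear (inj₁ ρ) y rewrite zeros (λ σ → shearSwap (inj₁ σ) y) | zeros (λ v → shearSwap (inj₂ v) y)
        = sym (+-identityʳ _)
      lowerShear (inj₂ v) (inj₁ x) rewrite zeros (λ u → shearSwap (inj₂ u) (inj₁ x))
        = cancel (δ v x) (sum (λ ρ → N v ρ * M ρ x))
        where
        cancel : ∀ p q → p ≡ (p - q) + (q + 0ℤ)
        cancel = solve-∀
      lowerShear (inj₂ v) (inj₂ σ) rewrite zeros (λ u → shearSwap (inj₂ u) (inj₂ σ)) | sum-δˡ σ (N v)
        = cancel (N v σ)
        where
        cancel : ∀ p → 0ℤ ≡ - p + (p + 0ℤ)
        cancel = solve-∀

      upperShear : ∀ x y → swapped x y ≡ sheared x y + rowSum (upperCoeff x) sheared y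
      upperShear (inj₁ ρ) (inj₁ x) rewrite zeros (λ σ → sheared (inj₁ σ) (inj₁ x)) | sum-δˡ x (λ v → - M ρ v)
        = cancel (M ρ x)
        where
        cancel : ∀ p → 0ℤ ≡ p + (0ℤ + - p)
        cancel = solve-∀
      upperShear (inj₁ ρ) (inj₂ σ) rewrite zeros (λ τ → sheared (inj₁ τ) (inj₂ σ))
        | sumℤ-zero (λ v → - M ρ v * 0ℤ) (λ v → *-zeroʳ (- M ρ v)) = sym (+-identityʳ _)
      upperShear (inj₂ v) y rewrite zeros (λ σ → sheared (inj₁ σ) y) | zeros (λ u → sheared (inj₂ u) y)
        = sym (+-identityʳ _)

      det-blockShear : (S : Fin r ⊎ Fin b → Bool) (X Y : BlockMatrix) (C : Fin r ⊎ Fin b → Fin r ⊎ Fin b → ℤ) →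
        (∀ x y → C x y ≡ 0ℤ ⊎ (S x ≡ true × S y ≡ false)) →
        (∀ x y → Y x y ≡ X x y + rowSum (C x) X y) → det (assemble Y) ≡ det (assemble X)
      det-blockShear S X Y C supp Y≡ = det-shear (S ∘ rowBlock) (assemble X) (assemble Y)
        (λ i k → C (rowBlock i) (rowBlock k)) (λ i k → supp (rowBlock i) (rowBlock k))
        (λ i c → trans (Y≡ (rowBlock i) (colBlock c)) (cong (λ z → X (rowBlock i) (colBlock c) + z)
          (sym (sum-splitAt r (λ x → C (rowBlock i) x * X x (colBlock c))))))

      swapped-unit : ∀ x → ∣ swapped x (Sum.swap x) ∣ ≡ 1
      swapped-unit (inj₁ ρ) = cong ∣_∣ (δ-refl ρ)
      swapped-unit (inj₂ v) = cong ∣_∣ (δ-refl v)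

      swapped-zero : ∀ x y → y ≢ Sum.swap x → swapped x y ≡ 0ℤ
      swapped-zero (inj₁ ρ) (inj₁ v) y≢ = refl
      swapped-zero (inj₁ ρ) (inj₂ σ) y≢ = δ-≢ (λ ρ≡σ → y≢ (cong inj₂ (sym ρ≡σ)))
      swapped-zero (inj₂ v) (inj₁ x) y≢ = δ-≢ (λ v≡x → y≢ (cong inj₁ (sym v≡x)))
      swapped-zero (inj₂ v) (inj₂ σ) y≢ = refl

      π : Fin (r ℕ.+ b) → Fin (r ℕ.+ b)
      π = colIndex ∘ Sum.swap ∘ rowBlock

      π-injective : ∀ i j → π i ≡ π j → i ≡ j
      π-injective i j πi≡πj = begin
        i                                         ≡⟨ inverse i ⟨
        join r b (Sum.swap (colBlock (π i)))      ≡⟨ cong (join r b ∘ Sum.swap ∘ colBlock) πi≡πj ⟩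
        join r b (Sum.swap (colBlock (π j)))      ≡⟨ inverse j ⟩
        j                                         ∎
        where
        open ≡-Reasoning
        inverse : ∀ i → join r b (Sum.swap (colBlock (π i))) ≡ i
        inverse i = trans (cong (join r b ∘ Sum.swap) (colBlock-colIndex (Sum.swap (rowBlock i))))
          (trans (cong (join r b) (swap-involutive (rowBlock i))) (join-splitAt r b i))

    ∣det-shearSwap∣≡1 : ∣ det (assemble shearSwap) ∣ ≡ 1
    ∣det-shearSwap∣≡1 = begin
      ∣ det (assemble shearSwap) ∣  ≡⟨ cong ∣_∣ (det-blockShear isLower shearSwap sheared lowerCoeff lowerSupport lowerShear) ⟨
      ∣ det (assemble sheared) ∣    ≡⟨ cong ∣_∣ (det-blockShear isUpper sheared swapped upperCoeff upperSupport upperShear) ⟨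
      ∣ det (assemble swapped) ∣    ≡⟨ det-monomial (assemble swapped) π π-injective
        (λ i → trans (cong (λ y → ∣ swapped (rowBlock i) y ∣) (colBlock-colIndex _)) (swapped-unit (rowBlock i)))
        (λ i c c≢πi → swapped-zero (rowBlock i) (colBlock c)
          (λ eq → c≢πi (trans (sym (colIndex-colBlock c)) (cong colIndex eq)))) ⟩
      1                             ∎
      where open ≡-Reasoning

-- Convex hulls of integer points

-- Normalised fractions do not compute for variable numerators, so the equation is checked on
-- unnormalised ones, where it becomes an identity of integers.
ι-+ : ∀ x y → ι (x + y) ≡ ι x ℚ.+ ι y
ι-+ x y = ℚ.toℚᵘ-injective (begin
  ℚ.toℚᵘ (ι (x + y))                   ≈⟨ ℚ.toℚᵘ-fromℚᵘ (mkℚᵘ (x + y) 0) ⟩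
  mkℚᵘ (x + y) 0                       ≈⟨ *≡* (numerators x y) ⟩
  mkℚᵘ x 0 ℚᵘ.+ mkℚᵘ y 0               ≈⟨ ℚᵘ.+-cong (ℚ.toℚᵘ-fromℚᵘ (mkℚᵘ x 0)) (ℚ.toℚᵘ-fromℚᵘ (mkℚᵘ y 0)) ⟨
  ℚ.toℚᵘ (ι x) ℚᵘ.+ ℚ.toℚᵘ (ι y)       ≈⟨ ℚ.toℚᵘ-homo-+ (ι x) (ι y) ⟨
  ℚ.toℚᵘ (ι x ℚ.+ ι y)                 ∎)
  where
  open ℚᵘ.≃-Reasoning
  numerators : ∀ x y → (x + y) * 1ℤ ≡ (x * 1ℤ + y * 1ℤ) * 1ℤ
  numerators = solve-∀

ι-* : ∀ x y → ι (x * y) ≡ ι x ℚ.* ι y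
ι-* x y = ℚ.toℚᵘ-injective (begin
  ℚ.toℚᵘ (ι (x * y))                   ≈⟨ ℚ.toℚᵘ-fromℚᵘ (mkℚᵘ (x * y) 0) ⟩
  mkℚᵘ x 0 ℚᵘ.* mkℚᵘ y 0               ≈⟨ ℚᵘ.*-cong (ℚ.toℚᵘ-fromℚᵘ (mkℚᵘ x 0)) (ℚ.toℚᵘ-fromℚᵘ (mkℚᵘ y 0)) ⟨
  ℚ.toℚᵘ (ι x) ℚᵘ.* ℚ.toℚᵘ (ι y)       ≈⟨ ℚ.toℚᵘ-homo-* (ι x) (ι y) ⟨
  ℚ.toℚᵘ (ι x ℚ.* ι y)                 ∎)
  where open ℚᵘ.≃-Reasoning

ι-sum : ∀ {n} (g : Fin n → ℤ) → ι (sum g) ≡ ∑ℚ.sum (ι ∘ g)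
ι-sum {zero}  g = refl
ι-sum {suc n} g = trans (ι-+ (g zero) (sum (g ∘ suc))) (cong (λ z → ι (g zero) ℚ.+ z) (ι-sum (g ∘ suc)))

Σℚ≡sum : ∀ n (g : Fin n → ℚ) → Σℚ n g ≡ ∑ℚ.sum g
Σℚ≡sum zero    g = refl
Σℚ≡sum (suc n) g = cong (λ z → g zero ℚ.+ z) (Σℚ≡sum n (g ∘ suc))

Σℚ-cong : ∀ n {g h : Fin n → ℚ} → (∀ i → g i ≡ h i) → Σℚ n g ≡ Σℚ n h
Σℚ-cong n {g} {h} g≡h = trans (Σℚ≡sum n g) (trans (∑ℚ.sum-cong-≗ g≡h) (sym (Σℚ≡sum n h)))

pointMass : ∀ {n} → Fin n → ℚ → Fin n → ℚ
pointMass a x j = if does (a ≟ j) then x else 0ℚ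

pointMass-≥0 : ∀ {n} (a : Fin n) x j → 0ℚ ℚ.≤ x → 0ℚ ℚ.≤ pointMass a x j
pointMass-≥0 a x j 0≤x with does (a ≟ j)
... | true  = 0≤x
... | false = ℚ.≤-refl

sum-pointMass : ∀ {n} (a : Fin n) x (F : Fin n → ℚ) → ∑ℚ.sum (λ j → pointMass a x j ℚ.* F j) ≡ x ℚ.* F a
sum-pointMass a x F = trans
  (sum-single (CommutativeRing.+-commutativeMonoid ℚ.+-*-commutativeRing) a _
    (λ j j≢a → trans (cong (λ b → (if b then x else 0ℚ) ℚ.* F j) (dec-false (a ≟ j) (j≢a ∘ sym))) (ℚ.*-zeroˡ (F j))))
  (cong (λ b → (if b then x else 0ℚ) ℚ.* F a) (dec-true (a ≟ a) refl))

-- Weights with the same image under `h` accumulate, one point mass at a time. Testing against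
-- arbitrary `F` yields both facts about hulls at once: constant `F` gives the total weight,
-- coordinate functions give the point.
pushforward : ∀ {k l} (h : Fin k → Fin l) (w : Fin k → ℚ) → (∀ c → 0ℚ ℚ.≤ w c) →
  Σ (Fin l → ℚ) λ μ → (∀ j → 0ℚ ℚ.≤ μ j) ×
    (∀ (F : Fin l → ℚ) → ∑ℚ.sum (λ j → μ j ℚ.* F j) ≡ ∑ℚ.sum (λ c → w c ℚ.* F (h c)))
pushforward {zero} {l} h w w≥0 = const 0ℚ , (λ _ → ℚ.≤-refl) ,
  λ F → sum-zero (CommutativeRing.+-commutativeMonoid ℚ.+-*-commutativeRing) _ (λ j → ℚ.*-zeroˡ (F j))
pushforward {suc k} {l} h w w≥0 with pushforward (h ∘ suc) (w ∘ suc) (w≥0 ∘ suc)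
... | μ , μ≥0 , μ-sum = μ⁺
  , (λ j → ℚ.+-mono-≤ (pointMass-≥0 (h zero) (w zero) j (w≥0 zero)) (μ≥0 j))
  , λ F → begin
    ∑ℚ.sum (λ j → μ⁺ j ℚ.* F j)
      ≡⟨ ∑ℚ.sum-cong-≗ (λ j → ℚ.*-distribʳ-+ (F j) (pointMass (h zero) (w zero) j) (μ j)) ⟩
    ∑ℚ.sum (λ j → pointMass (h zero) (w zero) j ℚ.* F j ℚ.+ μ j ℚ.* F j)
      ≡⟨ ∑ℚ.∑-distrib-+ (λ j → pointMass (h zero) (w zero) j ℚ.* F j) (λ j → μ j ℚ.* F j) ⟩
    ∑ℚ.sum (λ j → pointMass (h zero) (w zero) j ℚ.* F j) ℚ.+ ∑ℚ.sum (λ j → μ j ℚ.* F j)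
      ≡⟨ cong₂ ℚ._+_ (sum-pointMass (h zero) (w zero) F) (μ-sum F) ⟩
    ∑ℚ.sum (λ c → w c ℚ.* F (h c)) ∎
  where
  open ≡-Reasoning
  μ⁺ : Fin l → ℚ
  μ⁺ j = pointMass (h zero) (w zero) j ℚ.+ μ j

conv-reindex : ∀ {m k l} (p : Fin k → Point m) (q : Fin l → Point m) (h : Fin k → Fin l) →
  (∀ c i → p c i ≡ q (h c) i) → ∀ x → conv p x → conv q x
conv-reindex {k = k} {l} p q h p≡q x (w , w≥0 , w-sum , x≡) with pushforward h w w≥0
... | μ , μ≥0 , μ-sum = μ , μ≥0 , total , λ i → begin
    x i                                        ≡⟨ x≡ i ⟩
    Σℚ k (λ c → w c ℚ.* ι (p c i))             ≡⟨ Σℚ≡sum k _ ⟩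
    ∑ℚ.sum (λ c → w c ℚ.* ι (p c i))           ≡⟨ ∑ℚ.sum-cong-≗ (λ c → cong (λ z → w c ℚ.* ι z) (p≡q c i)) ⟩
    ∑ℚ.sum (λ c → w c ℚ.* ι (q (h c) i))       ≡⟨ μ-sum (λ j → ι (q j i)) ⟨
    ∑ℚ.sum (λ j → μ j ℚ.* ι (q j i))           ≡⟨ Σℚ≡sum l _ ⟨
    Σℚ l (λ j → μ j ℚ.* ι (q j i))             ∎
  where
  open ≡-Reasoning
  total : Σℚ l μ ≡ 1ℚ
  total = begin
    Σℚ l μ                        ≡⟨ Σℚ≡sum l μ ⟩
    ∑ℚ.sum μ                      ≡⟨ ∑ℚ.sum-cong-≗ (λ j → ℚ.*-identityʳ (μ j)) ⟨
    ∑ℚ.sum (λ j → μ j ℚ.* 1ℚ)     ≡⟨ μ-sum (const 1ℚ) ⟩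
    ∑ℚ.sum (λ c → w c ℚ.* 1ℚ)     ≡⟨ ∑ℚ.sum-cong-≗ (λ c → ℚ.*-identityʳ (w c)) ⟩
    ∑ℚ.sum w                      ≡⟨ Σℚ≡sum k w ⟨
    Σℚ k w                        ≡⟨ w-sum ⟩
    1ℚ                            ∎

_·_ : ∀ {m} → Matrix m → Point m → Point m
(U · y) i = sum (λ k → U i k * y k)

·-scale : ∀ {m} (U : Matrix m) u (y : Point m) i → (U · (λ k → u * y k)) i ≡ u * (U · y) i
·-scale U u y i = trans (sum-cong-≗ (λ k → swap-factors (U i k) u (y k))) (sym (*-distribˡ-sum u (λ k → U i k * y k)))
  where
  swap-factors : ∀ a u b → a * (u * b) ≡ u * (a * b)
  swap-factors = solve-∀

apply-combination : ∀ {m l} (U : Matrix m) (q : Fin l → Point m) (μ : Fin l → ℚ) i →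
  apply U (λ k → Σℚ l (λ j → μ j ℚ.* ι (q j k))) i ≡ Σℚ l (λ j → μ j ℚ.* ι ((U · q j) i))
apply-combination {m} {l} U q μ i = begin
  Σℚ m (λ k → ι (U i k) ℚ.* Σℚ l (λ j → μ j ℚ.* ι (q j k)))
    ≡⟨ Σℚ≡sum m _ ⟩
  ∑ℚ.sum (λ k → ι (U i k) ℚ.* Σℚ l (λ j → μ j ℚ.* ι (q j k)))
    ≡⟨ ∑ℚ.sum-cong-≗ (λ k → trans (cong (ι (U i k) ℚ.*_) (Σℚ≡sum l _)) (∑ℚ.*-distribˡ-sum (ι (U i k)) (λ j → μ j ℚ.* ι (q j k)))) ⟩
  ∑ℚ.sum (λ k → ∑ℚ.sum (λ j → ι (U i k) ℚ.* (μ j ℚ.* ι (q j k))))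
    ≡⟨ ∑ℚ.∑-comm (λ k j → ι (U i k) ℚ.* (μ j ℚ.* ι (q j k))) ⟩
  ∑ℚ.sum (λ j → ∑ℚ.sum (λ k → ι (U i k) ℚ.* (μ j ℚ.* ι (q j k))))
    ≡⟨ ∑ℚ.sum-cong-≗ (λ j → trans (∑ℚ.sum-cong-≗ (summand j)) (sym (∑ℚ.*-distribˡ-sum (μ j) (λ k → ι (U i k * q j k))))) ⟩
  ∑ℚ.sum (λ j → μ j ℚ.* ∑ℚ.sum (λ k → ι (U i k * q j k)))
    ≡⟨ ∑ℚ.sum-cong-≗ (λ j → cong (μ j ℚ.*_) (sym (ι-sum (λ k → U i k * q j k)))) ⟩
  ∑ℚ.sum (λ j → μ j ℚ.* ι ((U · q j) i))
    ≡⟨ Σℚ≡sum l _ ⟨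
  Σℚ l (λ j → μ j ℚ.* ι ((U · q j) i)) ∎
  where
  open ≡-Reasoning
  summand : ∀ j k → ι (U i k) ℚ.* (μ j ℚ.* ι (q j k)) ≡ μ j ℚ.* ι (U i k * q j k)
  summand j k = begin
    ι (U i k) ℚ.* (μ j ℚ.* ι (q j k))    ≡⟨ ℚ.*-assoc (ι (U i k)) (μ j) _ ⟨
    ι (U i k) ℚ.* μ j ℚ.* ι (q j k)      ≡⟨ cong (ℚ._* ι (q j k)) (ℚ.*-comm (ι (U i k)) (μ j)) ⟩
    μ j ℚ.* ι (U i k) ℚ.* ι (q j k)      ≡⟨ ℚ.*-assoc (μ j) (ι (U i k)) _ ⟩
    μ j ℚ.* (ι (U i k) ℚ.* ι (q j k))    ≡⟨ cong (μ j ℚ.*_) (ι-* (U i k) (q j k)) ⟨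
    μ j ℚ.* ι (U i k * q j k)            ∎

ZeroExtension : ∀ {a m k} → a ≤ m → (Fin k → Point a) → (Fin k → Point m) → Set
ZeroExtension {a} a≤m p p̂ = ∀ c → (∀ j → p̂ c (inject≤ j a≤m) ≡ p c j) × (∀ i → a ≤ toℕ i → p̂ c i ≡ 0ℤ)

inject≤-or-≥ : ∀ {a m} (a≤m : a ≤ m) (i : Fin m) → (∃ λ j → inject≤ j a≤m ≡ i) ⊎ a ≤ toℕ i
inject≤-or-≥ {a} a≤m i with toℕ i ℕ.<? a
... | yes i<a = inj₁ (fromℕ< i<a , toℕ-injective (trans (toℕ-inject≤ (fromℕ< i<a) a≤m) (toℕ-fromℕ< i<a)))
... | no  i≮a = inj₂ (ℕ.≮⇒≥ i≮a)

-- Turns padded polytopes into hulls in the common ambient space, where an equivalence can be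
-- reduced to finite sets of points.
pad-conv : ∀ {a m k} (a≤m : a ≤ m) (p : Fin k → Point a) (p̂ : Fin k → Point m) →
  ZeroExtension a≤m p p̂ → ∀ x → pad a≤m (conv p) x ⇔ conv p̂ x
pad-conv {a} {m} {k} a≤m p p̂ ext x = mk⇔ to from
  where
  outside : ∀ (w : Fin k → ℚ) i → a ≤ toℕ i → Σℚ k (λ c → w c ℚ.* ι (p̂ c i)) ≡ 0ℚ
  outside w i a≤i = trans (Σℚ≡sum k _) (sum-zero (CommutativeRing.+-commutativeMonoid ℚ.+-*-commutativeRing) _
    (λ c → trans (cong (λ z → w c ℚ.* ι z) (proj₂ (ext c) i a≤i)) (ℚ.*-zeroʳ (w c))))
  inside : ∀ (w : Fin k → ℚ) j → Σℚ k (λ c → w c ℚ.* ι (p̂ c (inject≤ j a≤m))) ≡ Σℚ k (λ c → w c ℚ.* ι (p c j))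
  inside w j = Σℚ-cong k (λ c → cong (λ z → w c ℚ.* ι z) (proj₁ (ext c) j))
  to : pad a≤m (conv p) x → conv p̂ x
  to (x≡0 , w , w≥0 , w-sum , x≡) = w , w≥0 , w-sum , λ i → coordinate i (inject≤-or-≥ a≤m i)
    where
    coordinate : ∀ i → (∃ λ j → inject≤ j a≤m ≡ i) ⊎ a ≤ toℕ i → x i ≡ Σℚ k (λ c → w c ℚ.* ι (p̂ c i))
    coordinate i (inj₁ (j , refl)) = trans (x≡ j) (sym (inside w j))
    coordinate i (inj₂ a≤i)        = trans (x≡0 i a≤i) (sym (outside w i a≤i))
  from : conv p̂ x → pad a≤m (conv p) x
  from (w , w≥0 , w-sum , x≡) = (λ i a≤i → trans (x≡ i) (outside w i a≤i)) ,
    w , w≥0 , w-sum , λ j → trans (x≡ (inject≤ j a≤m)) (inside w j)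

-- A linear map carries a hull to the hull of the images, so it is enough that `U` maps one finite
-- set of points onto the other.
unimodEquiv-conv : ∀ {a b m k l} (p : Fin k → Point a) (q : Fin l → Point b) (a≤m : a ≤ m) (b≤m : b ≤ m)
  (p̂ : Fin k → Point m) (q̂ : Fin l → Point m) → ZeroExtension a≤m p p̂ → ZeroExtension b≤m q q̂ →
  (U : Matrix m) → ∣ det U ∣ ≡ 1 →
  (∀ c → ∃ λ j → ∀ i → p̂ c i ≡ (U · q̂ j) i) → (∀ j → ∃ λ c → ∀ i → p̂ c i ≡ (U · q̂ j) i) →
  UnimodEquiv (conv p) (conv q)
unimodEquiv-conv {m = m} {k} {l} p q a≤m b≤m p̂ q̂ ext-p ext-q U ∣det∣≡1 onto from-q =
  m , a≤m , b≤m , U , ∣det∣≡1 , λ x → mk⇔ (to x) (from x)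
  where
  Uq̂ : Fin l → Point m
  Uq̂ j = U · q̂ j
  to : ∀ x → pad a≤m (conv p) x → Σ (Fin m → ℚ) λ y → pad b≤m (conv q) y × (∀ i → x i ≡ apply U y i)
  to x x∈P with conv-reindex p̂ Uq̂ (proj₁ ∘ onto) (proj₂ ∘ onto) x (Equivalence.to (pad-conv a≤m p p̂ ext-p x) x∈P)
  ... | μ , μ≥0 , μ-sum , x≡ = y , Equivalence.from (pad-conv b≤m q q̂ ext-q y) (μ , μ≥0 , μ-sum , λ _ → refl) ,
        λ i → trans (x≡ i) (sym (apply-combination U q̂ μ i))
    where
    -- The weights found for the images are put on the points `q̂` themselves, which gives a
    -- preimage of `x` without inverting `U`.
    y : Fin m → ℚ
    y i = Σℚ l (λ j → μ j ℚ.* ι (q̂ j i))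
  from : ∀ x → (Σ (Fin m → ℚ) λ y → pad b≤m (conv q) y × (∀ i → x i ≡ apply U y i)) → pad a≤m (conv p) x
  from x (y , y∈Q , x≡) with Equivalence.to (pad-conv b≤m q q̂ ext-q y) y∈Q
  ... | μ , μ≥0 , μ-sum , y≡ = Equivalence.from (pad-conv a≤m p p̂ ext-p x)
    (conv-reindex Uq̂ p̂ (proj₁ ∘ from-q) (λ j i → sym (proj₂ (from-q j) i)) x
      (μ , μ≥0 , μ-sum , λ i → trans (x≡ i)
        (trans (Σℚ-cong m (λ k → cong (ι (U i k) ℚ.*_) (y≡ k))) (apply-combination U q̂ μ i))))

-- Point configurations closed under negation

IsUnit : ℤ → Set
IsUnit u = u ≡ 1ℤ ⊎ u ≡ -1ℤ

isUnit-* : ∀ {u v} → IsUnit u → IsUnit v → IsUnit (u * v)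
isUnit-* (inj₁ refl) (inj₁ refl) = inj₁ refl
isUnit-* (inj₁ refl) (inj₂ refl) = inj₂ refl
isUnit-* (inj₂ refl) (inj₁ refl) = inj₂ refl
isUnit-* (inj₂ refl) (inj₂ refl) = inj₁ refl

isUnit-neg : ∀ {u} → IsUnit u → IsUnit (- u)
isUnit-neg (inj₁ refl) = inj₂ refl
isUnit-neg (inj₂ refl) = inj₁ refl

isUnit-cancel : ∀ {u} → IsUnit u → ∀ x → u * (u * x) ≡ x
isUnit-cancel (inj₁ refl) x = trans (*-identityˡ (1ℤ * x)) (*-identityˡ x)
isUnit-cancel (inj₂ refl) x = cancel x
  where
  cancel : ∀ x → -1ℤ * (-1ℤ * x) ≡ x
  cancel = solve-∀

∣unit∣≡1 : ∀ {u} → IsUnit u → ∣ u ∣ ≡ 1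
∣unit∣≡1 (inj₁ refl) = refl
∣unit∣≡1 (inj₂ refl) = refl

pm-point : ∀ {m k} (p : Fin k → Point m) i → ∃₂ λ c u → IsUnit u × (∀ r → pm p i r ≡ u * p c r)
pm-point {k = k} p i with splitAt k i
... | inj₁ c = c , 1ℤ , inj₁ refl , λ r → sym (*-identityˡ (p c r))
... | inj₂ c = c , -1ℤ , inj₂ refl , λ r → sym (-1*i≡-i (p c r))

pm-index : ∀ {m k} (p : Fin k → Point m) c u → IsUnit u → ∃ λ i → ∀ r → pm p i r ≡ u * p c r
pm-index {k = k} p c u (inj₁ refl) = join k k (inj₁ c) , λ r →
  trans (cong (λ s → [ p , (λ c r → - p c r) ]′ s r) (splitAt-join k k (inj₁ c))) (sym (*-identityˡ (p c r)))
pm-index {k = k} p c u (inj₂ refl) = join k k (inj₂ c) , λ r →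
  trans (cong (λ s → [ p , (λ c r → - p c r) ]′ s r) (splitAt-join k k (inj₂ c))) (sym (-1*i≡-i (p c r)))

pm-zeroExtension : ∀ {a m k} (a≤m : a ≤ m) (p : Fin k → Point a) (p̂ : Fin k → Point m) →
  ZeroExtension a≤m p p̂ → ZeroExtension a≤m (pm p) (pm p̂)
pm-zeroExtension {k = k} a≤m p p̂ ext i with splitAt k i
... | inj₁ c = ext c
... | inj₂ c = (λ j → cong -_ (proj₁ (ext c) j)) , (λ i a≤i → cong -_ (proj₂ (ext c) i a≤i))

-- A configuration containing all negatives absorbs signs: a unit in the matching only changes which
-- of the two opposite points is selected.
unimodEquiv-pm : ∀ {a b m k l} (p : Fin k → Point a) (q : Fin l → Point b) (a≤m : a ≤ m) (b≤m : b ≤ m)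
  (p̂ : Fin k → Point m) (q̂ : Fin l → Point m) → ZeroExtension a≤m p p̂ → ZeroExtension b≤m q q̂ →
  (U : Matrix m) → ∣ det U ∣ ≡ 1 →
  (∀ c → ∃₂ λ j u → IsUnit u × (∀ i → p̂ c i ≡ u * (U · q̂ j) i)) →
  (∀ j → ∃₂ λ c u → IsUnit u × (∀ i → p̂ c i ≡ u * (U · q̂ j) i)) →
  UnimodEquiv (conv (pm p)) (conv (pm q))
unimodEquiv-pm p q a≤m b≤m p̂ q̂ ext-p ext-q U ∣det∣≡1 onto from-q =
  unimodEquiv-conv (pm p) (pm q) a≤m b≤m (pm p̂) (pm q̂)
    (pm-zeroExtension a≤m p p̂ ext-p) (pm-zeroExtension b≤m q q̂ ext-q) U ∣det∣≡1 onto± from±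
  where
  open ≡-Reasoning
  scaled : ∀ u v {c j i i′} → IsUnit v → (∀ r → pm p̂ i r ≡ u * p̂ c r) → (∀ r → p̂ c r ≡ v * (U · q̂ j) r) →
    (∀ r → pm q̂ i′ r ≡ u * v * q̂ j r) → ∀ r → pm p̂ i r ≡ (U · pm q̂ i′) r
  scaled u v {c} {j} {i} {i′} v-unit i≡ c≡ i′≡ r = begin
    pm p̂ i r                            ≡⟨ i≡ r ⟩
    u * p̂ c r                           ≡⟨ cong (u *_) (c≡ r) ⟩
    u * (v * (U · q̂ j) r)               ≡⟨ *-assoc u v _ ⟨
    u * v * (U · q̂ j) r                 ≡⟨ ·-scale U (u * v) (q̂ j) r ⟨
    (U · (λ k → u * v * q̂ j k)) r       ≡⟨ sum-cong-≗ (λ k → cong (U r k *_) (i′≡ k)) ⟨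
    (U · pm q̂ i′) r                     ∎
  onto± : ∀ i → ∃ λ i′ → ∀ r → pm p̂ i r ≡ (U · pm q̂ i′) r
  onto± i with pm-point p̂ i
  ... | c , u , u-unit , i≡ with onto c
  ... | j , v , v-unit , c≡ with pm-index q̂ j (u * v) (isUnit-* u-unit v-unit)
  ... | i′ , i′≡ = i′ , scaled u v v-unit i≡ c≡ i′≡
  from± : ∀ i′ → ∃ λ i → ∀ r → pm p̂ i r ≡ (U · pm q̂ i′) r
  from± i′ with pm-point q̂ i′
  ... | j , u , u-unit , i′≡ with from-q j
  ... | c , v , v-unit , c≡ with pm-index p̂ c (u * v) (isUnit-* u-unit v-unit)
  -- The sign `u` is prescribed on the side of `q̂`, so `p̂ c` is taken with sign `u * v`; the
  -- matching multiplies by `v` once more and restores `u`.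
  ... | i , i≡ = i , scaled (u * v) v v-unit i≡ c≡ λ r → trans (i′≡ r) (cong (_* q̂ j r) (sym u*v*v≡u))
    where
    u*v*v≡u : u * v * v ≡ u
    u*v*v≡u = trans (rotate u v) (isUnit-cancel v-unit u)
      where
      rotate : ∀ u v → u * v * v ≡ v * (v * u)
      rotate = solve-∀

-- Incidence matrices and their factorisations

IsEdge : ∀ {s} → (Fin s → ℤ) → Fin s → Fin s → Set
IsEdge v a b = ∃ λ u → IsUnit u × (∀ c → v c ≡ u * (δ a c - δ b c))

isEdge-sym : ∀ {s} {v : Fin s → ℤ} a b → IsEdge v a b → IsEdge v b a
isEdge-sym a b (u , u-unit , v≡) = - u , isUnit-neg u-unit , λ c → trans (v≡ c) (flip u (δ a c) (δ b c))
  where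
  flip : ∀ u x y → u * (x - y) ≡ - u * (y - x)
  flip = solve-∀

Adjacent : ∀ {r s} → (Fin r → Fin s → ℤ) → Fin s → Fin s → Set
Adjacent V a b = ∃ λ ρ → IsEdge (V ρ) a b

-- The rows along a path telescope.
path-functional : ∀ {r s} (V : Fin r → Fin s → ℤ) {a b} → Star (Adjacent V) a b →
  ∃ λ ℓ → ∀ c → δ a c - δ b c ≡ sum (λ ρ → ℓ ρ * V ρ c)
path-functional V {a} ε = const 0ℤ , λ c →
  trans (+-inverseʳ (δ a c)) (sym (sumℤ-zero _ (λ ρ → *-zeroˡ (V ρ c))))
path-functional V {a} {b} (_◅_ {j = e} (ρ , u , u-unit , V≡) path) with path-functional V path
... | ℓ , ℓ≡ = (λ σ → δ ρ σ * u + ℓ σ) , λ c → begin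
    δ a c - δ b c                                                    ≡⟨ telescope (δ a c) (δ e c) (δ b c) ⟩
    (δ a c - δ e c) + (δ e c - δ b c)                                ≡⟨ cong₂ _+_ (step c) (ℓ≡ c) ⟩
    sum (λ σ → δ ρ σ * (u * V σ c)) + sum (λ σ → ℓ σ * V σ c)        ≡⟨ ∑-distrib-+ (λ σ → δ ρ σ * (u * V σ c)) (λ σ → ℓ σ * V σ c) ⟨
    sum (λ σ → δ ρ σ * (u * V σ c) + ℓ σ * V σ c)                    ≡⟨ sum-cong-≗ (λ σ → collect (δ ρ σ) u (ℓ σ) (V σ c)) ⟩
    sum (λ σ → (δ ρ σ * u + ℓ σ) * V σ c)                            ∎
  where
  open ≡-Reasoning
  telescope : ∀ x y z → x - z ≡ (x - y) + (y - z)
  telescope = solve-∀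
  collect : ∀ d u l x → d * (u * x) + l * x ≡ (d * u + l) * x
  collect = solve-∀
  step : ∀ c → δ a c - δ e c ≡ sum (λ σ → δ ρ σ * (u * V σ c))
  step c = sym (trans (sum-δʳ ρ (λ σ → u * V σ c)) (trans (cong (u *_) (V≡ c)) (isUnit-cancel u-unit _)))

factor-through : ∀ {r b s} (V : Fin r → Fin s → ℤ) (W : Fin b → Fin s → ℤ) →
  (∀ ρ → ∃₂ λ a b → IsEdge (V ρ) a b) → (∀ a b → Star (Adjacent W) a b) →
  Σ (Fin r → Fin b → ℤ) λ M → ∀ ρ c → V ρ c ≡ sum (λ k → M ρ k * W k c)
factor-through {r} {b} V W edges connected = M , V≡MW
  where
  M : Fin r → Fin b → ℤ
  M ρ k with edges ρ
  ... | x , y , u , _ = u * proj₁ (path-functional W (connected x y)) k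
  V≡MW : ∀ ρ c → V ρ c ≡ sum (λ k → M ρ k * W k c)
  V≡MW ρ c with edges ρ
  ... | x , y , u , _ , V≡ with path-functional W (connected x y)
  ... | ℓ , ℓ≡ = begin
    V ρ c                            ≡⟨ V≡ c ⟩
    u * (δ x c - δ y c)              ≡⟨ cong (u *_) (ℓ≡ c) ⟩
    u * sum (λ k → ℓ k * W k c)      ≡⟨ *-distribˡ-sum u (λ k → ℓ k * W k c) ⟩
    sum (λ k → u * (ℓ k * W k c))    ≡⟨ sum-cong-≗ (λ k → *-assoc u (ℓ k) (W k c)) ⟨
    sum (λ k → u * ℓ k * W k c)      ∎
    where open ≡-Reasoning

-- Two assignments up to sign instead of a bijection, because several indices may give one column:
-- for s = 2 the single edge of the cycle graph accounts for both columns of `cycleIncidence`.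
SameColumns : ∀ {a k s} → (Fin k → Point a) → (Fin a → Fin s → ℤ) → Set
SameColumns {a} {k} {s} A V =
  (∀ c → ∃₂ λ i u → IsUnit u × (∀ ρ → A c ρ ≡ u * V ρ i)) ×
  (∀ i → ∃₂ λ c u → IsUnit u × (∀ ρ → A c ρ ≡ u * V ρ i))

module _ {a b k l s} (A : Fin k → Point a) (B : Fin l → Point b)
  (V : Fin a → Fin s → ℤ) (W : Fin b → Fin s → ℤ)
  (A~V : SameColumns A V) (B~W : SameColumns B W)
  (V-edges : ∀ ρ → ∃₂ λ x y → IsEdge (V ρ) x y) (V-connected : ∀ x y → Star (Adjacent V) x y)
  (W-edges : ∀ ρ → ∃₂ λ x y → IsEdge (W ρ) x y) (W-connected : ∀ x y → Star (Adjacent W) x y)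
  where

  open Blocks a b

  private
    M = proj₁ (factor-through V W V-edges W-connected)
    V≡MW = proj₂ (factor-through V W V-edges W-connected)
    N = proj₁ (factor-through W V W-edges V-connected)
    W≡NV = proj₂ (factor-through W V W-edges V-connected)

    U = assemble (shearSwap M N)

    topRows : Point a → Fin a ⊎ Fin b → ℤ
    topRows v = [ v , const 0ℤ ]′

    leftCols : Point b → Fin b ⊎ Fin a → ℤ
    leftCols w = [ w , const 0ℤ ]′

    Â : Fin k → Point (a ℕ.+ b)
    Â c = topRows (A c) ∘ rowBlock

    B̂ : Fin l → Point (a ℕ.+ b)
    B̂ j = leftCols (B j) ∘ colBlock

    zeroExtension-Â : ZeroExtension (ℕ.m≤m+n a b) A Â
    zeroExtension-Â c =
        (λ j → cong (topRows (A c)) (trans (cong (splitAt a) (inject≤≡↑ˡ j)) (splitAt-↑ˡ a j b)))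
      , (λ i a≤i → cong (topRows (A c)) (splitAt-≥ a i a≤i))
      where
      inject≤≡↑ˡ : ∀ j → inject≤ j (ℕ.m≤m+n a b) ≡ j ↑ˡ b
      inject≤≡↑ˡ j = toℕ-injective (trans (toℕ-inject≤ j (ℕ.m≤m+n a b)) (sym (toℕ-↑ˡ j b)))

    zeroExtension-B̂ : ZeroExtension (ℕ.m≤n+m b a) B B̂
    zeroExtension-B̂ c =
        (λ j → cong (leftCols (B c)) (trans (cong (splitAt b) (cast-inject≤ j)) (splitAt-↑ˡ b j a)))
      , (λ i b≤i → cong (leftCols (B c))
          (splitAt-≥ b (cast (ℕ.+-comm a b) i) (ℕ.≤-trans b≤i (ℕ.≤-reflexive (sym (toℕ-cast (ℕ.+-comm a b) i))))))
      where
      cast-inject≤ : ∀ j → cast (ℕ.+-comm a b) (inject≤ j (ℕ.m≤n+m b a)) ≡ j ↑ˡ a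
      cast-inject≤ j = toℕ-injective (trans (toℕ-cast (ℕ.+-comm a b) _)
        (trans (toℕ-inject≤ j (ℕ.m≤n+m b a)) (sym (toℕ-↑ˡ j a))))

    U·leftCols : ∀ (w : Point b) i → (U · (leftCols w ∘ colBlock)) i ≡ sum (λ x → shearSwap M N (rowBlock i) (inj₁ x) * w x)
    U·leftCols w i = trans (sum-colBlock (λ y → shearSwap M N (rowBlock i) y * leftCols w y))
      (trans (cong (λ z → sum (λ x → shearSwap M N (rowBlock i) (inj₁ x) * w x) + z)
               (sumℤ-zero _ (λ σ → *-zeroʳ (shearSwap M N (rowBlock i) (inj₂ σ)))))
             (+-identityʳ _))

    -- Both factorisations enter: M W = V is the upper block, and N M W = N V = W makes the lower
    -- block vanish.
    shearSwap-column : ∀ i x → sum (λ v → shearSwap M N x (inj₁ v) * W v i) ≡ topRows (λ ρ → V ρ i) x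
    shearSwap-column i (inj₁ ρ) = sym (V≡MW ρ i)
    shearSwap-column i (inj₂ v) = begin
      sum (λ x → (δ v x - NM x) * W x i)                        ≡⟨ sum-cong-≗ (λ x → distrib (δ v x) (NM x) (W x i)) ⟩
      sum (λ x → δ v x * W x i + -1ℤ * (NM x * W x i))          ≡⟨ ∑-distrib-+ (λ x → δ v x * W x i) (λ x → -1ℤ * (NM x * W x i)) ⟩
      sum (λ x → δ v x * W x i) + sum (λ x → -1ℤ * (NM x * W x i))
        ≡⟨ cong₂ _+_ (sum-δʳ v (λ x → W x i)) (sym (*-distribˡ-sum -1ℤ (λ x → NM x * W x i))) ⟩
      W v i + -1ℤ * sum (λ x → NM x * W x i)                    ≡⟨ cong (λ z → W v i + -1ℤ * z) NMW≡W ⟩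
      W v i + -1ℤ * W v i                                       ≡⟨ cancel (W v i) ⟩
      0ℤ                                                        ∎
      where
      open ≡-Reasoning
      NM : Fin b → ℤ
      NM x = sum (λ ρ → N v ρ * M ρ x)
      distrib : ∀ d n w → (d - n) * w ≡ d * w + -1ℤ * (n * w)
      distrib = solve-∀
      cancel : ∀ w → w + -1ℤ * w ≡ 0ℤ
      cancel = solve-∀
      NMW≡W : sum (λ x → NM x * W x i) ≡ W v i
      NMW≡W = begin
        sum (λ x → NM x * W x i)                               ≡⟨ sum-cong-≗ (λ x → *-distribʳ-sum (W x i) (λ ρ → N v ρ * M ρ x)) ⟩
        sum (λ x → sum (λ ρ → N v ρ * M ρ x * W x i))          ≡⟨ ∑-comm (λ x ρ → N v ρ * M ρ x * W x i) ⟩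
        sum (λ ρ → sum (λ x → N v ρ * M ρ x * W x i))
          ≡⟨ sum-cong-≗ (λ ρ → trans (sum-cong-≗ (λ x → *-assoc (N v ρ) (M ρ x) (W x i))) (sym (*-distribˡ-sum (N v ρ) (λ x → M ρ x * W x i)))) ⟩
        sum (λ ρ → N v ρ * sum (λ x → M ρ x * W x i))          ≡⟨ sum-cong-≗ (λ ρ → cong (N v ρ *_) (V≡MW ρ i)) ⟨
        sum (λ ρ → N v ρ * V ρ i)                              ≡⟨ W≡NV v i ⟨
        W v i                                                  ∎

    matched : ∀ {c j i u v} → IsUnit v → (∀ ρ → A c ρ ≡ u * V ρ i) → (∀ x → B j x ≡ v * W x i) →
      ∀ r → Â c r ≡ u * v * (U · B̂ j) r
    matched {c} {j} {i} {u} {v} v-unit A≡ B≡ r = begin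
      topRows (A c) (rowBlock r)                ≡⟨ scaledTop (rowBlock r) ⟩
      -- The factor `v * v` = 1 is inserted: one `v` turns column `i` of `W` into `B j`, the other
      -- joins the sign `u * v`.
      u * topRows (λ ρ → V ρ i) (rowBlock r)    ≡⟨ cong (u *_) (isUnit-cancel v-unit _) ⟨
      u * (v * (v * topRows (λ ρ → V ρ i) (rowBlock r)))
        ≡⟨ cong (λ z → u * (v * (v * z))) (shearSwap-column i (rowBlock r)) ⟨
      u * (v * (v * sum (λ x → shearSwap M N (rowBlock r) (inj₁ x) * W x i)))
        ≡⟨ cong (λ z → u * (v * z)) (*-distribˡ-sum v (λ x → shearSwap M N (rowBlock r) (inj₁ x) * W x i)) ⟩
      u * (v * sum (λ x → v * (shearSwap M N (rowBlock r) (inj₁ x) * W x i)))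
        ≡⟨ cong (λ z → u * (v * z)) (sum-cong-≗ (λ x → trans (swap-factors v (shearSwap M N (rowBlock r) (inj₁ x)) (W x i))
             (cong (shearSwap M N (rowBlock r) (inj₁ x) *_) (sym (B≡ x))))) ⟩
      u * (v * sum (λ x → shearSwap M N (rowBlock r) (inj₁ x) * B j x))
        ≡⟨ cong (λ z → u * (v * z)) (U·leftCols (B j) r) ⟨
      u * (v * (U · B̂ j) r)                     ≡⟨ *-assoc u v _ ⟨
      u * v * (U · B̂ j) r                       ∎
      where
      open ≡-Reasoning
      swap-factors : ∀ v m w → v * (m * w) ≡ m * (v * w)
      swap-factors = solve-∀
      scaledTop : ∀ x → topRows (A c) x ≡ u * topRows (λ ρ → V ρ i) x
      scaledTop (inj₁ ρ) = A≡ ρ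
      scaledTop (inj₂ y) = sym (*-zeroʳ u)

  unimodEquiv-incidence : UnimodEquiv (conv (pm A)) (conv (pm B))
  unimodEquiv-incidence = unimodEquiv-pm A B (ℕ.m≤m+n a b) (ℕ.m≤n+m b a) Â B̂ zeroExtension-Â zeroExtension-B̂
    U (∣det-shearSwap∣≡1 M N) onto from-B
    where
    onto : ∀ c → ∃₂ λ j u → IsUnit u × (∀ r → Â c r ≡ u * (U · B̂ j) r)
    onto c with proj₁ A~V c
    ... | i , u , u-unit , A≡ with proj₂ B~W i
    ... | j , v , v-unit , B≡ = j , u * v , isUnit-* u-unit v-unit , matched {u = u} {v} v-unit A≡ B≡
    from-B : ∀ j → ∃₂ λ c u → IsUnit u × (∀ r → Â c r ≡ u * (U · B̂ j) r)
    from-B j with proj₁ B~W j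
    ... | i , v , v-unit , B≡ with proj₂ A~V i
    ... | c , u , u-unit , A≡ = c , u * v , isUnit-* u-unit v-unit , matched {u = u} {v} v-unit A≡ B≡

-- Faces

∧-trueˡ : ∀ {x y} → x ∧ y ≡ true → x ≡ true
∧-trueˡ {true} _ = refl

∧-trueʳ : ∀ {x y} → x ∧ y ≡ true → y ≡ true
∧-trueʳ {true} y≡true = y≡true

≡⇒≡ᵇ-true : ∀ {m n} → m ≡ n → (m ≡ᵇ n) ≡ true
≡⇒≡ᵇ-true {m} {n} m≡n = Equivalence.to T-≡ (ℕ.≡⇒≡ᵇ m n m≡n)

≡ᵇ-true⇒≡ : ∀ m n → (m ≡ᵇ n) ≡ true → m ≡ n
≡ᵇ-true⇒≡ m n eq = ℕ.≡ᵇ⇒≡ m n (Equivalence.from T-≡ eq)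

∈-allSubsets : ∀ {n} (σ : Subset n) → σ ∈ allSubsets n
∈-allSubsets []          = here refl
∈-allSubsets (true ∷ σ)  = ∈-++⁺ˡ (∈-map⁺ (true ∷_) (∈-allSubsets σ))
∈-allSubsets (false ∷ σ) = ∈-++⁺ʳ (List.map (true ∷_) (allSubsets _)) (∈-map⁺ (false ∷_) (∈-allSubsets σ))

allSubsets-unique : ∀ n → Unique (allSubsets n)
allSubsets-unique zero    = All.[] ∷ []
allSubsets-unique (suc n) = Unique.++⁺
  (Unique.map⁺ (cong Vec.tail) (allSubsets-unique n)) (Unique.map⁺ (cong Vec.tail) (allSubsets-unique n))
  λ (∈-true , ∈-false) → disjoint (proj₂ (proj₂ (∈-map⁻ (true ∷_) ∈-true))) (proj₂ (proj₂ (∈-map⁻ (false ∷_) ∈-false)))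
  where
  disjoint : ∀ {σ : Subset (suc n)} {τ υ} → σ ≡ true ∷ τ → ¬ σ ≡ false ∷ υ
  disjoint refl ()

lookup-injective : ∀ {A : Set} {xs : List A} → Unique xs → ∀ i j → lookup xs i ≡ lookup xs j → i ≡ j
lookup-injective (x∉ ∷ uniq) zero    zero    eq = refl
lookup-injective (x∉ ∷ uniq) zero    (suc j) eq = contradiction eq (All.lookup x∉ (∈-lookup j))
lookup-injective (x∉ ∷ uniq) (suc i) zero    eq = contradiction (sym eq) (All.lookup x∉ (∈-lookup i))
lookup-injective (x∉ ∷ uniq) (suc i) (suc j) eq = cong suc (lookup-injective uniq i j eq)

module _ {n} (K : Complex n) (j : ℕ) where

  private
    isFace : Subset n → Bool
    isFace σ = K σ ∧ (Subset.∣ σ ∣ ≡ᵇ suc j)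

    jFace-isFace : ∀ i → isFace (jFace K j i) ≡ true
    jFace-isFace i = Equivalence.to T-≡ (proj₂ (∈-filter⁻ (T? ∘ isFace) {xs = allSubsets n} (∈-lookup i)))

  jFace-∈ : ∀ i → K (jFace K j i) ≡ true
  jFace-∈ i = ∧-trueˡ (jFace-isFace i)

  ∣jFace∣ : ∀ i → Subset.∣ jFace K j i ∣ ≡ suc j
  ∣jFace∣ i = ≡ᵇ-true⇒≡ _ _ (∧-trueʳ {K (jFace K j i)} (jFace-isFace i))

  jFace-surjective : ∀ σ → K σ ≡ true → Subset.∣ σ ∣ ≡ suc j → ∃ λ i → jFace K j i ≡ σ
  jFace-surjective σ σ∈K ∣σ∣≡ = index σ∈faces , sym (lookup-index σ∈faces)
    where
    σ∈faces : σ ∈ faces K j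
    σ∈faces = ∈-filter⁺ (T? ∘ isFace) (∈-allSubsets σ)
      (Equivalence.from T-≡ (cong₂ _∧_ σ∈K (≡⇒≡ᵇ-true ∣σ∣≡)))

  jFace-injective : ∀ a b → jFace K j a ≡ jFace K j b → a ≡ b
  jFace-injective = lookup-injective (Unique.filter⁺ (T? ∘ isFace) (allSubsets-unique n))

-- Boundary coefficients

-- Replaces the `with` in the definition by a term to which equations about `removed` can be
-- applied.
bdCoeff≡ : ∀ {n} (τ σ : Subset n) → bdCoeff τ σ ≡ maybe sign 0ℤ (removed τ σ)
bdCoeff≡ τ σ with removed τ σ
... | nothing = refl
... | just k  = refl

≟ˢ-refl : ∀ {n} (σ : Subset n) → (σ ≟ˢ σ) ≡ true
≟ˢ-refl []          = refl
≟ˢ-refl (true ∷ σ)  = ≟ˢ-refl σ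
≟ˢ-refl (false ∷ σ) = ≟ˢ-refl σ

≟ˢ⇒⊆ᵇ : ∀ {n} (τ σ : Subset n) → (τ ≟ˢ σ) ≡ true → (τ ⊆ᵇ σ) ≡ true
≟ˢ⇒⊆ᵇ []          []          eq = refl
≟ˢ⇒⊆ᵇ (true ∷ τ)  (true ∷ σ)  eq = ≟ˢ⇒⊆ᵇ τ σ eq
≟ˢ⇒⊆ᵇ (false ∷ τ) (false ∷ σ) eq = ≟ˢ⇒⊆ᵇ τ σ eq

⊆ᵇ⇒∣∣≤ : ∀ {n} (τ σ : Subset n) → (τ ⊆ᵇ σ) ≡ true → Subset.∣ τ ∣ ≤ Subset.∣ σ ∣
⊆ᵇ⇒∣∣≤ []          []          τ⊆σ = z≤n
⊆ᵇ⇒∣∣≤ (true ∷ τ)  (true ∷ σ)  τ⊆σ = s≤s (⊆ᵇ⇒∣∣≤ τ σ τ⊆σ)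
⊆ᵇ⇒∣∣≤ (false ∷ τ) (true ∷ σ)  τ⊆σ = ℕ.m≤n⇒m≤1+n (⊆ᵇ⇒∣∣≤ τ σ τ⊆σ)
⊆ᵇ⇒∣∣≤ (false ∷ τ) (false ∷ σ) τ⊆σ = ⊆ᵇ⇒∣∣≤ τ σ τ⊆σ

⊆ᵇ∧∣∣≡⇒≡ : ∀ {n} (τ σ : Subset n) → (τ ⊆ᵇ σ) ≡ true → Subset.∣ τ ∣ ≡ Subset.∣ σ ∣ → τ ≡ σ
⊆ᵇ∧∣∣≡⇒≡ []          []          τ⊆σ eq = refl
⊆ᵇ∧∣∣≡⇒≡ (true ∷ τ)  (true ∷ σ)  τ⊆σ eq = cong (true ∷_) (⊆ᵇ∧∣∣≡⇒≡ τ σ τ⊆σ (ℕ.suc-injective eq))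
⊆ᵇ∧∣∣≡⇒≡ (false ∷ τ) (true ∷ σ)  τ⊆σ eq = contradiction (⊆ᵇ⇒∣∣≤ τ σ τ⊆σ) (ℕ.<⇒≱ (ℕ.≤-reflexive (sym eq)))
⊆ᵇ∧∣∣≡⇒≡ (false ∷ τ) (false ∷ σ) τ⊆σ eq = cong (false ∷_) (⊆ᵇ∧∣∣≡⇒≡ τ σ τ⊆σ eq)

⊆ᵇ-∩ : ∀ {n} (ρ σ τ : Subset n) → (ρ ⊆ᵇ σ) ≡ true → (ρ ⊆ᵇ τ) ≡ true → (ρ ⊆ᵇ (σ ∩ τ)) ≡ true
⊆ᵇ-∩ []          []          []         ρ⊆σ ρ⊆τ = refl
⊆ᵇ-∩ (true ∷ ρ)  (true ∷ σ)  (true ∷ τ) ρ⊆σ ρ⊆τ = ⊆ᵇ-∩ ρ σ τ ρ⊆σ ρ⊆τ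
⊆ᵇ-∩ (false ∷ ρ) (_ ∷ σ)     (_ ∷ τ)    ρ⊆σ ρ⊆τ = ⊆ᵇ-∩ ρ σ τ ρ⊆σ ρ⊆τ

∩⊆ᵇˡ : ∀ {n} (σ τ : Subset n) → ((σ ∩ τ) ⊆ᵇ σ) ≡ true
∩⊆ᵇˡ []          []          = refl
∩⊆ᵇˡ (true ∷ σ)  (true ∷ τ)  = ∩⊆ᵇˡ σ τ
∩⊆ᵇˡ (true ∷ σ)  (false ∷ τ) = ∩⊆ᵇˡ σ τ
∩⊆ᵇˡ (false ∷ σ) (_ ∷ τ)     = ∩⊆ᵇˡ σ τ

∩⊆ᵇʳ : ∀ {n} (σ τ : Subset n) → ((σ ∩ τ) ⊆ᵇ τ) ≡ true
∩⊆ᵇʳ []          []          = refl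
∩⊆ᵇʳ (true ∷ σ)  (true ∷ τ)  = ∩⊆ᵇʳ σ τ
∩⊆ᵇʳ (true ∷ σ)  (false ∷ τ) = ∩⊆ᵇʳ σ τ
∩⊆ᵇʳ (false ∷ σ) (_ ∷ τ)     = ∩⊆ᵇʳ σ τ

facetOf : ∀ {n} (σ : Subset n) k → Subset.∣ σ ∣ ≡ suc k → ∃ λ ρ → (ρ ⊆ᵇ σ) ≡ true × Subset.∣ ρ ∣ ≡ k
facetOf (true ∷ σ)  k eq = false ∷ σ , ≟ˢ⇒⊆ᵇ σ σ (≟ˢ-refl σ) , ℕ.suc-injective eq
facetOf (false ∷ σ) k eq with facetOf σ k eq
... | ρ , ρ⊆σ , ∣ρ∣≡k = false ∷ ρ , ρ⊆σ , ∣ρ∣≡k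

removed-⊈ : ∀ {n} (τ σ : Subset n) → (τ ⊆ᵇ σ) ≡ false → removed τ σ ≡ nothing
removed-⊈ []          []          ()
removed-⊈ (false ∷ τ) (false ∷ σ) τ⊈σ = removed-⊈ τ σ τ⊈σ
removed-⊈ (true ∷ τ)  (true ∷ σ)  τ⊈σ = cong (Maybe.map suc) (removed-⊈ τ σ τ⊈σ)
removed-⊈ (true ∷ τ)  (false ∷ σ) τ⊈σ = refl
removed-⊈ (false ∷ τ) (true ∷ σ)  τ⊈σ with τ ≟ˢ σ in eq
... | true  = contradiction (trans (sym (≟ˢ⇒⊆ᵇ τ σ eq)) τ⊈σ) λ ()
... | false = refl

-- Past the first element of `σ` missing from `τ` the remaining parts have equal size, so the
-- inclusion between them is an equality and the test `≟ˢ` succeeds.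
removed-⊆ : ∀ {n} (τ σ : Subset n) → (τ ⊆ᵇ σ) ≡ true → Subset.∣ σ ∣ ≡ suc Subset.∣ τ ∣ → ∃ λ k → removed τ σ ≡ just k
removed-⊆ (false ∷ τ) (false ∷ σ) τ⊆σ eq = removed-⊆ τ σ τ⊆σ eq
removed-⊆ (true ∷ τ)  (true ∷ σ)  τ⊆σ eq with removed-⊆ τ σ τ⊆σ (ℕ.suc-injective eq)
... | k , removed≡ = suc k , cong (Maybe.map suc) removed≡
removed-⊆ (false ∷ τ) (true ∷ σ)  τ⊆σ eq
  rewrite ⊆ᵇ∧∣∣≡⇒≡ τ σ τ⊆σ (sym (ℕ.suc-injective eq)) | ≟ˢ-refl σ = 0 , refl

isUnit-sign : ∀ k → IsUnit (sign k)
isUnit-sign zero    = inj₁ refl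
isUnit-sign (suc k) = isUnit-neg (isUnit-sign k)

bdCoeff-⊈ : ∀ {n} (τ σ : Subset n) → (τ ⊆ᵇ σ) ≡ false → bdCoeff τ σ ≡ 0ℤ
bdCoeff-⊈ τ σ τ⊈σ = trans (bdCoeff≡ τ σ) (cong (maybe sign 0ℤ) (removed-⊈ τ σ τ⊈σ))

bdCoeff-⊆ : ∀ {n} (τ σ : Subset n) → (τ ⊆ᵇ σ) ≡ true → Subset.∣ σ ∣ ≡ suc Subset.∣ τ ∣ → IsUnit (bdCoeff τ σ)
bdCoeff-⊆ τ σ τ⊆σ eq with removed-⊆ τ σ τ⊆σ eq
... | k , removed≡ = subst IsUnit (sym (trans (bdCoeff≡ τ σ) (cong (maybe sign 0ℤ) removed≡))) (isUnit-sign k)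

-- Graphs as one-dimensional complexes

filterᵇ-cong : ∀ {A : Set} {p q : A → Bool} → (∀ x → p x ≡ q x) → ∀ xs → filterᵇ p xs ≡ filterᵇ q xs
filterᵇ-cong p≡q [] = refl
filterᵇ-cong {p = p} {q} p≡q (x ∷ xs) with p x | q x | p≡q x
... | true  | true  | _ = cong (x ∷_) (filterᵇ-cong p≡q xs)
... | false | false | _ = filterᵇ-cong p≡q xs

filterᵇ-map : ∀ {A B : Set} (p : B → Bool) (g : A → B) xs → filterᵇ p (List.map g xs) ≡ List.map g (filterᵇ (p ∘ g) xs)
filterᵇ-map p g [] = refl
filterᵇ-map p g (x ∷ xs) with p (g x)
... | true  = cong (g x ∷_) (filterᵇ-map p g xs)
... | false = filterᵇ-map p g xs

filterᵇ-none : ∀ {A : Set} (xs : List A) → filterᵇ (const false) xs ≡ []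
filterᵇ-none []       = refl
filterᵇ-none (x ∷ xs) = filterᵇ-none xs

filterᵇ-allSubsets : ∀ {n} (p : Subset (suc n) → Bool) → filterᵇ p (allSubsets (suc n)) ≡
  List.map (true ∷_) (filterᵇ (p ∘ (true ∷_)) (allSubsets n)) ++ List.map (false ∷_) (filterᵇ (p ∘ (false ∷_)) (allSubsets n))
filterᵇ-allSubsets {n} p = trans (filter-++ (T? ∘ p) (List.map (true ∷_) (allSubsets n)) _)
  (cong₂ _++_ (filterᵇ-map p (true ∷_) (allSubsets n)) (filterᵇ-map p (false ∷_) (allSubsets n)))

emptySubsets : ∀ n → filterᵇ (λ σ → Subset.∣ σ ∣ ≡ᵇ 0) (allSubsets n) ≡ ⊥ ∷ []
emptySubsets zero    = refl
emptySubsets (suc n) = trans (filterᵇ-allSubsets (λ σ → Subset.∣ σ ∣ ≡ᵇ 0))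
  (cong₂ (λ xs ys → List.map (true ∷_) xs ++ List.map (false ∷_) ys) (filterᵇ-none (allSubsets n)) (emptySubsets n))

-- Subsets containing the first element are listed first, so the singletons appear in the order of
-- their elements and the position of a 0-face is its vertex.
singletonSubsets : ∀ n → filterᵇ (λ σ → Subset.∣ σ ∣ ≡ᵇ 1) (allSubsets n) ≡ tabulate ⁅_⁆
singletonSubsets zero    = refl
singletonSubsets (suc n) = trans (filterᵇ-allSubsets (λ σ → Subset.∣ σ ∣ ≡ᵇ 1))
  (trans (cong₂ (λ xs ys → List.map (true ∷_) xs ++ List.map (false ∷_) ys) (emptySubsets n) (singletonSubsets n))
         (cong ((true ∷ ⊥) ∷_) (map-tabulate ⁅_⁆ (false ∷_))))

length-≡tabulate : ∀ {A : Set} {n} {xs : List A} {g : Fin n → A} → xs ≡ tabulate g → length xs ≡ n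
length-≡tabulate {g = g} refl = length-tabulate g

lookup-≡tabulate : ∀ {A : Set} {n} {xs : List A} {g : Fin n → A} → xs ≡ tabulate g →
  (le : length xs ≤ n) → ∀ i → lookup xs i ≡ g (inject≤ i le)
lookup-≡tabulate {n = n} {g = g} refl = lookup-tabulate g
  where
  lookup-tabulate : ∀ {A : Set} {n} (g : Fin n → A) (le : length (tabulate g) ≤ n) i → lookup (tabulate g) i ≡ g (inject≤ i le)
  lookup-tabulate {n = suc n} g le zero    = refl
  lookup-tabulate {n = suc n} g le (suc i) = lookup-tabulate (g ∘ suc) (ℕ.s≤s⁻¹ le) i

allB⁻ : ∀ {A : Set} (g : A → Bool) xs → allB g xs ≡ true → ∀ {x} → x ∈ xs → g x ≡ true
allB⁻ g (x ∷ xs) all (here refl)  = ∧-trueˡ all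
allB⁻ g (x ∷ xs) all (there x∈xs) = allB⁻ g xs (∧-trueʳ {g x} all) x∈xs

allB⁺ : ∀ {A : Set} (g : A → Bool) xs → (∀ x → g x ≡ true) → allB g xs ≡ true
allB⁺ g []       all = refl
allB⁺ g (x ∷ xs) all = cong₂ _∧_ (all x) (allB⁺ g xs all)

∣σ∣≡0⇒σ≡⊥ : ∀ {n} (σ : Subset n) → Subset.∣ σ ∣ ≡ 0 → σ ≡ ⊥
∣σ∣≡0⇒σ≡⊥ []          eq = refl
∣σ∣≡0⇒σ≡⊥ (false ∷ σ) eq = cong (false ∷_) (∣σ∣≡0⇒σ≡⊥ σ eq)

∣σ∣≡1⇒σ≡⁅b⁆ : ∀ {n} (σ : Subset n) → Subset.∣ σ ∣ ≡ 1 → ∃ λ b → σ ≡ ⁅ b ⁆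
∣σ∣≡1⇒σ≡⁅b⁆ (true ∷ σ)  eq = zero , cong (true ∷_) (∣σ∣≡0⇒σ≡⊥ σ (ℕ.suc-injective eq))
∣σ∣≡1⇒σ≡⁅b⁆ (false ∷ σ) eq with ∣σ∣≡1⇒σ≡⁅b⁆ σ eq
... | b , σ≡⁅b⁆ = suc b , cong (false ∷_) σ≡⁅b⁆

removed-⊥ : ∀ {n} (b : Fin n) → removed ⊥ ⁅ b ⁆ ≡ just 0
removed-⊥ {suc n} zero rewrite ≟ˢ-refl (⊥ {n}) = refl
removed-⊥ (suc b) = removed-⊥ b

⁅⁆≟ˢ⁅⁆ : ∀ {n} (b c : Fin n) → (⁅ c ⁆ ≟ˢ ⁅ b ⁆) ≡ does (b ≟ c)
⁅⁆≟ˢ⁅⁆ {suc n} zero zero    = ≟ˢ-refl (⊥ {n})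
⁅⁆≟ˢ⁅⁆ zero    (suc c) = refl
⁅⁆≟ˢ⁅⁆ (suc b) zero    = refl
⁅⁆≟ˢ⁅⁆ (suc b) (suc c) = ⁅⁆≟ˢ⁅⁆ b c

lookup-⁅⁆ : ∀ {n} (a : Fin n) → Vec.lookup ⁅ a ⁆ a ≡ true
lookup-⁅⁆ a = []=⇒lookup (x∈⁅x⁆ a)

-- The witness `a` is the smaller vertex: removing it leaves `b` with sign +1, and removing `b`
-- leaves `a` with sign -1.
∂-edge : ∀ {n} (σ : Subset n) → Subset.∣ σ ∣ ≡ 2 →
  ∃₂ λ a b → a ≢ b × Vec.lookup σ a ≡ true × Vec.lookup σ b ≡ true × (∀ c → bdCoeff ⁅ c ⁆ σ ≡ δ b c - δ a c)
∂-edge (false ∷ σ) eq with ∂-edge σ eq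
... | a , b , a≢b , a∈σ , b∈σ , ∂≡ = suc a , suc b , a≢b ∘ suc-injective , a∈σ , b∈σ , coefficient
  where
  coefficient : ∀ c → bdCoeff ⁅ c ⁆ (false ∷ σ) ≡ δ (suc b) c - δ (suc a) c
  coefficient zero    = refl
  coefficient (suc c) = trans (bdCoeff≡ (false ∷ ⁅ c ⁆) (false ∷ σ)) (trans (sym (bdCoeff≡ ⁅ c ⁆ σ)) (∂≡ c))
∂-edge (true ∷ σ) eq with ∣σ∣≡1⇒σ≡⁅b⁆ σ (ℕ.suc-injective eq)
... | b , refl = zero , suc b , (λ ()) , refl , lookup-⁅⁆ b , coefficient
  where
  coefficient : ∀ c → bdCoeff ⁅ c ⁆ (true ∷ ⁅ b ⁆) ≡ δ (suc b) c - δ zero c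
  coefficient zero    = trans (bdCoeff≡ (true ∷ ⊥) (true ∷ ⁅ b ⁆))
    (cong (maybe sign 0ℤ ∘ Maybe.map suc) (removed-⊥ b))
  coefficient (suc c) rewrite bdCoeff≡ (false ∷ ⁅ c ⁆) (true ∷ ⁅ b ⁆) | ⁅⁆≟ˢ⁅⁆ b c with does (b ≟ c)
  ... | true  = refl
  ... | false = refl

lookup-pair : ∀ {n} (a b i : Fin n) → Vec.lookup (⁅ a ⁆ ∪ ⁅ b ⁆) i ≡ true → i ≡ a ⊎ i ≡ b
lookup-pair a b i i∈ with Vec.lookup ⁅ a ⁆ i in i∈⁅a⁆ | trans (sym (lookup-zipWith _∨_ i ⁅ a ⁆ ⁅ b ⁆)) i∈
... | true  | _      = inj₁ (x∈⁅y⁆⇒x≡y a (lookup⇒[]= i ⁅ a ⁆ i∈⁅a⁆))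
... | false | i∈⁅b⁆ = inj₂ (x∈⁅y⁆⇒x≡y b (lookup⇒[]= i ⁅ b ⁆ i∈⁅b⁆))

∣pair∣≡2 : ∀ {n} (a b : Fin n) → a ≢ b → Subset.∣ ⁅ a ⁆ ∪ ⁅ b ⁆ ∣ ≡ 2
∣pair∣≡2 zero    zero    a≢b = contradiction refl a≢b
∣pair∣≡2 zero    (suc b) a≢b = cong suc (trans (cong Subset.∣_∣ (∪-identityˡ ⁅ b ⁆)) (∣⁅x⁆∣≡1 b))
∣pair∣≡2 (suc a) zero    a≢b = cong suc (trans (cong Subset.∣_∣ (∪-identityʳ ⁅ a ⁆)) (∣⁅x⁆∣≡1 a))
∣pair∣≡2 (suc a) (suc b) a≢b = ∣pair∣≡2 a b (a≢b ∘ cong suc)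

module _ {s} (adj : Fin s → Fin s → Bool) where

  private
    G = graphComplex adj

    vertices≡ : faces G 0 ≡ tabulate ⁅_⁆
    vertices≡ = trans (filterᵇ-cong vertex (allSubsets s)) (singletonSubsets s)
      where
      vertex : ∀ σ → G σ ∧ (Subset.∣ σ ∣ ≡ᵇ 1) ≡ (Subset.∣ σ ∣ ≡ᵇ 1)
      vertex σ with Subset.∣ σ ∣
      ... | 0 = refl
      ... | 1 = refl
      ... | suc (suc k) = ∧-zeroʳ _

    compatible : Subset s → Fin s → Fin s → Bool
    compatible σ i j = not (Vec.lookup σ i ∧ Vec.lookup σ j) ∨ (toℕ i ≡ᵇ toℕ j) ∨ adj i j

    edge-adj : ∀ σ → G σ ≡ true → Subset.∣ σ ∣ ≡ 2 → ∀ i j → i ≢ j →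
      Vec.lookup σ i ≡ true → Vec.lookup σ j ≡ true → adj i j ≡ true
    edge-adj σ σ∈G ∣σ∣≡2 i j i≢j i∈σ j∈σ rewrite ∣σ∣≡2 =
      extract (allB⁻ _ (allFin s) (allB⁻ (λ i → allB (compatible σ i) (allFin s)) (allFin s) σ∈G (∈-allFin i)) (∈-allFin j))
      where
      extract : compatible σ i j ≡ true → adj i j ≡ true
      extract ok rewrite i∈σ | j∈σ with toℕ i ≡ᵇ toℕ j in eq
      ... | true  = contradiction (toℕ-injective (≡ᵇ-true⇒≡ _ _ eq)) i≢j
      ... | false = ok

    -- `graphComplex` tests all ordered pairs of elements, so adjacency enters in both directions.
    pair∈G : ∀ a b → a ≢ b → adj a b ≡ true → adj b a ≡ true → G (⁅ a ⁆ ∪ ⁅ b ⁆) ≡ true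
    pair∈G a b a≢b ab ba rewrite ∣pair∣≡2 a b a≢b =
      allB⁺ _ (allFin s) λ i → allB⁺ (compatible (⁅ a ⁆ ∪ ⁅ b ⁆) i) (allFin s) (ok i)
      where
      ok : ∀ i j → compatible (⁅ a ⁆ ∪ ⁅ b ⁆) i j ≡ true
      ok i j with Vec.lookup (⁅ a ⁆ ∪ ⁅ b ⁆) i in i∈ | Vec.lookup (⁅ a ⁆ ∪ ⁅ b ⁆) j in j∈
      ... | false | _     = refl
      ... | true  | false = refl
      ... | true  | true with lookup-pair a b i i∈ | lookup-pair a b j j∈
      ... | inj₁ refl | inj₁ refl rewrite ≡⇒≡ᵇ-true {toℕ i} refl = refl
      ... | inj₂ refl | inj₂ refl rewrite ≡⇒≡ᵇ-true {toℕ i} refl = refl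
      ... | inj₁ refl | inj₂ refl rewrite ab = ∨-zeroʳ _
      ... | inj₂ refl | inj₁ refl rewrite ba = ∨-zeroʳ _

  vertexCount : f G 0 ≡ s
  vertexCount = length-≡tabulate vertices≡

  vertexCount≤ : f G 0 ≤ s
  vertexCount≤ = ℕ.≤-reflexive vertexCount

  -- The number of vertices equals `s` only propositionally. The identification is by `inject≤`, the
  -- map used in padding, so the padded columns of the boundary matrix are the vectors `edgeVector`.
  graphVertex : Fin (f G 0) → Fin s
  graphVertex v = inject≤ v vertexCount≤

  jFace-vertex : ∀ v → jFace G 0 v ≡ ⁅ graphVertex v ⁆
  jFace-vertex = lookup-≡tabulate vertices≡ vertexCount≤

  graphVertex-surjective : ∀ k → ∃ λ v → graphVertex v ≡ k
  graphVertex-surjective k = cast (sym vertexCount) k ,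
    toℕ-injective (trans (toℕ-inject≤ _ vertexCount≤) (toℕ-cast (sym vertexCount) k))

  edgeVector : Fin (f G 1) → Point s
  edgeVector e k = bdCoeff ⁅ k ⁆ (jFace G 1 e)

  ∂-edgeVector : ∀ v e → ∂ G 1 v e ≡ edgeVector e (graphVertex v)
  ∂-edgeVector v e = cong (λ τ → bdCoeff τ (jFace G 1 e)) (jFace-vertex v)

  edgeVector-isEdge : ∀ e → ∃₂ λ a b → adj a b ≡ true × IsEdge (edgeVector e) a b
  edgeVector-isEdge e with ∂-edge (jFace G 1 e) (∣jFace∣ G 1 e)
  ... | a , b , a≢b , a∈σ , b∈σ , ∂≡ = a , b
    , edge-adj (jFace G 1 e) (jFace-∈ G 1 e) (∣jFace∣ G 1 e) a b a≢b a∈σ b∈σ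
    , isEdge-sym b a (1ℤ , inj₁ refl , λ c → trans (∂≡ c) (sym (*-identityˡ (δ b c - δ a c))))

  isEdge-edgeVector : ∀ a b → a ≢ b → adj a b ≡ true → adj b a ≡ true → ∃ λ e → IsEdge (edgeVector e) a b
  isEdge-edgeVector a b a≢b ab ba with jFace-surjective G 1 (⁅ a ⁆ ∪ ⁅ b ⁆) (pair∈G a b a≢b ab ba) (∣pair∣≡2 a b a≢b)
  ... | e , σ≡ = e , subst (λ σ → IsEdge (λ k → bdCoeff ⁅ k ⁆ σ) a b) (sym σ≡) pair-isEdge
    where
    pair-isEdge : IsEdge (λ k → bdCoeff ⁅ k ⁆ (⁅ a ⁆ ∪ ⁅ b ⁆)) a b
    pair-isEdge with ∂-edge (⁅ a ⁆ ∪ ⁅ b ⁆) (∣pair∣≡2 a b a≢b)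
    ... | x , y , x≢y , x∈ , y∈ , ∂≡ with lookup-pair a b x x∈ | lookup-pair a b y y∈
    ... | inj₁ refl | inj₁ refl = contradiction refl x≢y
    ... | inj₂ refl | inj₂ refl = contradiction refl x≢y
    ... | inj₂ refl | inj₁ refl = 1ℤ , inj₁ refl , λ c → trans (∂≡ c) (sym (*-identityˡ (δ a c - δ b c)))
    ... | inj₁ refl | inj₂ refl =
      isEdge-sym b a (1ℤ , inj₁ refl , λ c → trans (∂≡ c) (sym (*-identityˡ (δ b c - δ a c))))

∨-trueʳ : ∀ x {y} → y ≡ true → x ∨ y ≡ true
∨-trueʳ x refl = ∨-zeroʳ x

∨-trueˡ : ∀ {x y} → x ≡ true → x ∨ y ≡ true
∨-trueˡ refl = refl

∨-true : ∀ {x y} → x ∨ y ≡ true → x ≡ true ⊎ y ≡ true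
∨-true {true}  _  = inj₁ refl
∨-true {false} eq = inj₂ eq

-- Symmetric edge polytopes up to signs of coordinates

module _ {r s} (adj : Fin s → Fin s → Bool) (A : Fin r → Point s)
  (o : Fin s → ℤ) (o-unit : ∀ i → IsUnit (o i)) (V : Fin r → Fin s → ℤ) (A≡oV : ∀ ρ i → A ρ i ≡ o i * V ρ i)
  (V-edges : ∀ ρ → ∃₂ λ a b → a ≢ b × adj a b ≡ true × adj b a ≡ true × IsEdge (V ρ) a b)
  (adj⇒edge : ∀ a b → adj a b ≡ true → Adjacent V a b)
  where

  private
    signs : Matrix s
    signs i k = o i * δ i k

    ∣det-signs∣≡1 : ∣ det signs ∣ ≡ 1
    ∣det-signs∣≡1 = det-monomial signs id (λ i j eq → eq)
      (λ i → trans (cong (λ x → ∣ o i * x ∣) (δ-refl i)) (trans (cong ∣_∣ (*-identityʳ (o i))) (∣unit∣≡1 (o-unit i))))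
      (λ i c c≢i → trans (cong (o i *_) (δ-≢ (c≢i ∘ sym))) (*-zeroʳ (o i)))

    signs·≡ : ∀ (y : Point s) i → (signs · y) i ≡ o i * y i
    signs·≡ y i = trans (sum-cong-≗ (λ k → commute (o i) (δ i k) (y k))) (sum-δʳ i (λ k → o i * y k))
      where
      commute : ∀ e d y → e * d * y ≡ d * (e * y)
      commute = solve-∀

    SignedRow : Fin r → Fin (f (graphComplex adj) 1) → Set
    SignedRow ρ e = ∃ λ u → IsUnit u × (∀ i → A ρ i ≡ u * (signs · edgeVector adj e) i)

    signedRow : ∀ {ρ e} a b → IsEdge (V ρ) a b → IsEdge (edgeVector adj e) a b → SignedRow ρ e
    signedRow {ρ} {e} a b (u , u-unit , V≡) (v , v-unit , e≡) = u * v , isUnit-* u-unit v-unit , λ i → begin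
      A ρ i                                     ≡⟨ A≡oV ρ i ⟩
      o i * V ρ i                               ≡⟨ cong (o i *_) (V≡ i) ⟩
      o i * (u * (δ a i - δ b i))               ≡⟨ cong (λ x → o i * (u * x)) (isUnit-cancel v-unit _) ⟨
      o i * (u * (v * (v * (δ a i - δ b i))))   ≡⟨ cong (λ x → o i * (u * (v * x))) (e≡ i) ⟨
      o i * (u * (v * edgeVector adj e i))      ≡⟨ regroup (o i) u v (edgeVector adj e i) ⟩
      u * v * (o i * edgeVector adj e i)        ≡⟨ cong (u * v *_) (signs·≡ (edgeVector adj e) i) ⟨
      u * v * (signs · edgeVector adj e) i      ∎
      where
      open ≡-Reasoning
      regroup : ∀ o u v x → o * (u * (v * x)) ≡ u * v * (o * x)
      regroup = solve-∀

    row-edge : ∀ ρ → ∃ (SignedRow ρ)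
    row-edge ρ = from (V-edges ρ)
      where
      from : (∃₂ λ a b → a ≢ b × adj a b ≡ true × adj b a ≡ true × IsEdge (V ρ) a b) → ∃ (SignedRow ρ)
      from (a , b , a≢b , ab , ba , edge) = Product.map₂ (signedRow a b edge) (isEdge-edgeVector adj a b a≢b ab ba)

    edge-row : ∀ e → ∃ λ ρ → SignedRow ρ e
    edge-row e = from (edgeVector-isEdge adj e)
      where
      from : (∃₂ λ a b → adj a b ≡ true × IsEdge (edgeVector adj e) a b) → ∃ λ ρ → SignedRow ρ e
      from (a , b , ab , edge) = Product.map₂ (λ V-edge → signedRow a b V-edge edge) (adj⇒edge a b ab)

  -- Both polytopes already have `s` coordinates, one for each vertex of the graph. No coordinates
  -- are added, and the conditions on padding zeros are vacuous.
  unimodEquiv-graph : UnimodEquiv (conv (pm A)) (SymEdgePoly adj)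
  unimodEquiv-graph = unimodEquiv-pm A (λ e v → ∂ (graphComplex adj) 1 v e)
    ℕ.≤-refl (vertexCount≤ adj) A (edgeVector adj)
    (λ ρ → (λ i → cong (A ρ) (inject≤-refl i ℕ.≤-refl)) , λ i s≤i → contradiction (toℕ<n i) (ℕ.≤⇒≯ s≤i))
    (λ e → (λ v → sym (∂-edgeVector adj v e)) ,
           λ i s≤i → contradiction (toℕ<n i) (ℕ.≤⇒≯ (ℕ.≤-trans (ℕ.≤-reflexive (sym (vertexCount adj))) s≤i)))
    signs ∣det-signs∣≡1 row-edge edge-row

-- The cycle graph

cyclicPred : ∀ {n} → Fin (suc n) → Fin (suc n)
cyclicPred zero    = fromℕ _
cyclicPred (suc i) = inject₁ i

cyclicPred-injective : ∀ {n} (i j : Fin (suc n)) → cyclicPred i ≡ cyclicPred j → i ≡ j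
cyclicPred-injective zero    zero    eq = refl
cyclicPred-injective zero    (suc j) eq = contradiction eq fromℕ≢inject₁
cyclicPred-injective (suc i) zero    eq = contradiction (sym eq) fromℕ≢inject₁
cyclicPred-injective (suc i) (suc j) eq = cong suc (inject₁-injective eq)

cyclicPred-surjective : ∀ {n} (k : Fin (suc n)) → ∃ λ i → cyclicPred i ≡ k
cyclicPred-surjective {n} k with n ℕ.≟ toℕ k
... | yes n≡k = zero , toℕ-injective (trans (toℕ-fromℕ n) n≡k)
... | no  n≢k = suc (lower₁ k n≢k) , inject₁-lower₁ k n≢k

cyclicPred-≢ : ∀ {n} (i : Fin (suc (suc n))) → cyclicPred i ≢ i
cyclicPred-≢ (suc i) eq = ℕ.1+n≢n (sym (trans (sym (toℕ-inject₁ i)) (cong toℕ eq)))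

cycleAdj-cyclicPred : ∀ {n} (i : Fin (suc n)) →
  cycleAdj (suc n) (cyclicPred i) i ≡ true × cycleAdj (suc n) i (cyclicPred i) ≡ true
cycleAdj-cyclicPred {n} zero rewrite toℕ-fromℕ n | ≡⇒≡ᵇ-true {n} refl =
  ∨-trueʳ ((n ≡ᵇ 0) ∧ (0 ≡ᵇ n)) (∨-trueʳ (n ≡ᵇ 1) refl) , ∨-trueˡ (∨-trueʳ (n ≡ᵇ 1) refl)
cycleAdj-cyclicPred {n} (suc i) rewrite toℕ-inject₁ i | ≡⇒≡ᵇ-true {toℕ i} refl =
  refl , ∨-trueʳ _ refl

cycleAdj⇒cyclicPred : ∀ {n} (a b : Fin (suc n)) → cycleAdj (suc n) a b ≡ true → a ≡ cyclicPred b ⊎ b ≡ cyclicPred a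
cycleAdj⇒cyclicPred {n} a b ab = [ directed a b , Sum.swap ∘ directed b a ]′ (∨-true ab)
  where
  successor : ∀ {n} (a b : Fin (suc n)) → toℕ b ≡ suc (toℕ a) → a ≡ cyclicPred b
  successor a (suc b) eq = toℕ-injective (trans (sym (ℕ.suc-injective eq)) (sym (toℕ-inject₁ b)))
  wrap : ∀ (a b : Fin (suc n)) → toℕ a ≡ 0 → toℕ b ≡ n → b ≡ cyclicPred a
  wrap zero b _ b≡n = toℕ-injective (trans b≡n (sym (toℕ-fromℕ n)))
  directed : ∀ a b → (toℕ b ≡ᵇ suc (toℕ a)) ∨ ((toℕ a ≡ᵇ 0) ∧ (toℕ b ≡ᵇ n)) ≡ true → a ≡ cyclicPred b ⊎ b ≡ cyclicPred a
  directed a b ab with ∨-true ab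
  ... | inj₁ b≡1+a = inj₁ (successor a b (≡ᵇ-true⇒≡ _ _ b≡1+a))
  ... | inj₂ wraps = inj₂ (wrap a b (≡ᵇ-true⇒≡ _ _ (∧-trueˡ wraps)) (≡ᵇ-true⇒≡ _ _ (∧-trueʳ {toℕ a ≡ᵇ 0} wraps)))

-- What the equivalence uses of the cycle graph: a permutation without fixed points whose steps are
-- exactly the edges, and which reaches every vertex from `root`.
record CyclicOrder {s} (adj : Fin s → Fin s → Bool) : Set where
  field
    pred            : Fin s → Fin s
    pred-injective  : ∀ i j → pred i ≡ pred j → i ≡ j
    pred-surjective : ∀ k → ∃ λ i → pred i ≡ k
    pred-≢          : ∀ i → pred i ≢ i
    root            : Fin s
    pred-path       : ∀ i → Star (λ a b → a ≡ pred b) root i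
    adj-pred        : ∀ i → adj (pred i) i ≡ true × adj i (pred i) ≡ true
    adj⇒pred        : ∀ a b → adj a b ≡ true → a ≡ pred b ⊎ b ≡ pred a

cyclicOrder : ∀ {s} → 2 ≤ s → CyclicOrder (cycleAdj s)
cyclicOrder {suc (suc n)} (s≤s (s≤s z≤n)) = record
  { pred            = cyclicPred
  ; pred-injective  = cyclicPred-injective
  ; pred-surjective = cyclicPred-surjective
  ; pred-≢          = cyclicPred-≢
  ; root            = zero
  ; pred-path       = <-weakInduction _ ε (λ i path → path ◅◅ (refl ◅ ε))
  ; adj-pred        = cycleAdj-cyclicPred
  ; adj⇒pred        = cycleAdj⇒cyclicPred
  }

δ-sym : ∀ {n} (i j : Fin n) → δ i j ≡ δ j i
δ-sym i j with i ≟ j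
... | yes refl = sym (δ-refl i)
... | no  i≢j  = sym (δ-≢ (i≢j ∘ sym))

module _ {s} {adj : Fin s → Fin s → Bool} (order : CyclicOrder adj) where

  open CyclicOrder order

  private
    vertex = graphVertex adj

  -- Edges are numbered by their heads: column `i` is the edge from `pred i` to `i`. Row `v` thus
  -- meets two columns, the edge entering `v`, numbered by `v` itself, and the edge leaving it,
  -- numbered by the successor of `v`.
  cycleIncidence : Fin (f (graphComplex adj) 0) → Fin s → ℤ
  cycleIncidence v i = δ i (vertex v) - δ (pred i) (vertex v)

  cycleIncidence-isEdge : ∀ v i → pred i ≡ vertex v → IsEdge (cycleIncidence v) (vertex v) i
  cycleIncidence-isEdge v i pred-i≡v = 1ℤ , inj₁ refl , λ c →
    trans (cong₂ _-_ (δ-sym c (vertex v)) (δ-pred c)) (sym (*-identityˡ _))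
    where
    δ-pred : ∀ c → δ (pred c) (vertex v) ≡ δ i c
    δ-pred c with i ≟ c
    ... | yes refl = trans (cong (δ (pred i)) (sym pred-i≡v)) (δ-refl (pred i))
    ... | no  i≢c  = δ-≢ (λ pred-c≡v → i≢c (pred-injective i c (trans pred-i≡v (sym pred-c≡v))))

  cycleIncidence-edges : ∀ v → ∃₂ λ a b → IsEdge (cycleIncidence v) a b
  cycleIncidence-edges v with pred-surjective (vertex v)
  ... | i , pred-i≡v = vertex v , i , cycleIncidence-isEdge v i pred-i≡v

  cycleIncidence-connected : ∀ a b → Star (Adjacent cycleIncidence) a b
  cycleIncidence-connected a b = reverse (λ {x} {y} → adjacent-sym {x} {y}) (from-root a) ◅◅ from-root b
    where
    adjacent-sym : ∀ {a b} → Adjacent cycleIncidence a b → Adjacent cycleIncidence b a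
    adjacent-sym {a} {b} (v , edge) = v , isEdge-sym a b edge
    step : ∀ {a b} → a ≡ pred b → Adjacent cycleIncidence a b
    step {a} {b} a≡pred-b with graphVertex-surjective adj a
    ... | v , v≡a = v , subst (λ k → IsEdge (cycleIncidence v) k b) v≡a
                          (cycleIncidence-isEdge v b (trans (sym a≡pred-b) (sym v≡a)))
    from-root : ∀ i → Star (Adjacent cycleIncidence) root i
    from-root i = Star.map step (pred-path i)

  -- The boundary map directs an edge from its smaller to its larger vertex, `cycleIncidence`
  -- directs it along the cycle. For `cycleAdj` they disagree in the column that closes the cycle,
  -- hence the units.
  cycle-sameColumns : SameColumns (λ e v → ∂ (graphComplex adj) 1 v e) cycleIncidence
  cycle-sameColumns = edge-column , column-edge
    where
    SignedColumn : Fin (f (graphComplex adj) 1) → Fin s → Set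
    SignedColumn e i = ∃ λ u → IsUnit u × (∀ v → ∂ (graphComplex adj) 1 v e ≡ u * cycleIncidence v i)
    forward : ∀ {e} i → IsEdge (edgeVector adj e) i (pred i) → SignedColumn e i
    forward {e} i (u , u-unit , e≡) = u , u-unit , λ v → trans (∂-edgeVector adj v e) (e≡ (vertex v))
    backward : ∀ {e} i → IsEdge (edgeVector adj e) (pred i) i → SignedColumn e i
    backward i edge = forward i (isEdge-sym (pred i) i edge)
    edge-column : ∀ e → ∃ (SignedColumn e)
    edge-column e = oriented (edgeVector-isEdge adj e)
      where
      oriented : (∃₂ λ a b → adj a b ≡ true × IsEdge (edgeVector adj e) a b) → ∃ (SignedColumn e)
      oriented (a , b , ab , edge) =
        [ (λ a≡pred-b → b , backward b (subst (λ c → IsEdge (edgeVector adj e) c b) a≡pred-b edge))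
        , (λ b≡pred-a → a , forward a (subst (IsEdge (edgeVector adj e) a) b≡pred-a edge))
        ]′ (adj⇒pred a b ab)
    column-edge : ∀ i → ∃ λ e → SignedColumn e i
    column-edge i = Product.map₂ (forward i)
      (isEdge-edgeVector adj i (pred i) (pred-≢ i ∘ sym) (proj₂ (adj-pred i)) (proj₁ (adj-pred i)))

unimodEquiv-cycle : ∀ {a k s} {adj : Fin s → Fin s → Bool} → CyclicOrder adj → (A : Fin k → Point a) (V : Fin a → Fin s → ℤ) → SameColumns A V →
  (∀ ρ → ∃₂ λ x y → IsEdge (V ρ) x y) → (∀ x y → Star (Adjacent V) x y) →
  UnimodEquiv (conv (pm A)) (SymEdgePoly adj)
unimodEquiv-cycle {adj = adj} order A V A~V V-edges V-connected =
  unimodEquiv-incidence A (λ e v → ∂ (graphComplex adj) 1 v e) V (cycleIncidence order)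
    A~V (cycle-sameColumns order) V-edges V-connected (cycleIncidence-edges order) (cycleIncidence-connected order)

-- Ridges and facets

length-filterᵇ≡0 : ∀ {A : Set} (p : A → Bool) xs → length (filterᵇ p xs) ≡ 0 → ∀ c → p (lookup xs c) ≡ false
length-filterᵇ≡0 p (x ∷ xs) eq c with p x in px
length-filterᵇ≡0 p (x ∷ xs) eq zero    | false = px
length-filterᵇ≡0 p (x ∷ xs) eq (suc c) | false = length-filterᵇ≡0 p xs eq c

length-filterᵇ≡1 : ∀ {A : Set} (p : A → Bool) xs → length (filterᵇ p xs) ≡ 1 →
  ∃ λ a → p (lookup xs a) ≡ true × (∀ c → c ≢ a → p (lookup xs c) ≡ false)
length-filterᵇ≡1 p (x ∷ xs) eq with p x in px
... | true = zero , px , others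
  where
  others : ∀ c → c ≢ zero → p (lookup (x ∷ xs) c) ≡ false
  others zero    c≢ = contradiction refl c≢
  others (suc c) c≢ = length-filterᵇ≡0 p xs (ℕ.suc-injective eq) c
... | false with length-filterᵇ≡1 p xs eq
... | a , pa , rest = suc a , pa , others
  where
  others : ∀ c → c ≢ suc a → p (lookup (x ∷ xs) c) ≡ false
  others zero    c≢ = px
  others (suc c) c≢ = rest c (c≢ ∘ cong suc)

-- Positions are returned instead of entries, because the columns of the boundary matrix are
-- positions in the list of facets.
length-filterᵇ≡2 : ∀ {A : Set} (p : A → Bool) xs → length (filterᵇ p xs) ≡ 2 →
  ∃₂ λ a b → a ≢ b × p (lookup xs a) ≡ true × p (lookup xs b) ≡ true ×
    (∀ c → c ≢ a → c ≢ b → p (lookup xs c) ≡ false)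
length-filterᵇ≡2 p (x ∷ xs) eq with p x in px
... | true with length-filterᵇ≡1 p xs (ℕ.suc-injective eq)
... | b , pb , rest = zero , suc b , (λ ()) , px , pb , others
  where
  others : ∀ c → c ≢ zero → c ≢ suc b → p (lookup (x ∷ xs) c) ≡ false
  others zero    c≢a c≢b = contradiction refl c≢a
  others (suc c) c≢a c≢b = rest c (c≢b ∘ cong suc)
length-filterᵇ≡2 p (x ∷ xs) eq | false with length-filterᵇ≡2 p xs eq
... | a , b , a≢b , pa , pb , rest = suc a , suc b , a≢b ∘ suc-injective , pa , pb , others
  where
  others : ∀ c → c ≢ suc a → c ≢ suc b → p (lookup (x ∷ xs) c) ≡ false
  others zero    c≢a c≢b = px
  others (suc c) c≢a c≢b = rest c (c≢a ∘ cong suc) (c≢b ∘ cong suc)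

sum-pair : ∀ {n} (a b : Fin n) (g : Fin n → ℤ) → a ≢ b → (∀ c → c ≢ a → c ≢ b → g c ≡ 0ℤ) → sum g ≡ g a + g b
sum-pair {suc n} a b g a≢b g≡0 = trans (sum-remove {i = a} g)
  (cong (λ z → g a + z) (trans (sumℤ-single (punchOut a≢b) _ zeros) (cong g (punchIn-punchOut a≢b))))
  where
  zeros : ∀ j → j ≢ punchOut a≢b → g (punchIn a j) ≡ 0ℤ
  zeros j j≢ = g≡0 (punchIn a j) (punchInᵢ≢i a j)
    (λ eq → j≢ (punchIn-injective a j _ (trans eq (sym (punchIn-punchOut a≢b)))))

foldr-map-tabulate : ∀ {A : Set} n (h : Fin n → A) (g : A → ℤ) →
  List.foldr _+_ (+ 0) (List.map g (tabulate h)) ≡ sum (g ∘ h)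
foldr-map-tabulate zero    h g = refl
foldr-map-tabulate (suc n) h g = cong (λ z → g (h zero) + z) (foldr-map-tabulate n (h ∘ suc) g)

-- Zero is given the sign 1, so that every value is a unit.
signum : ℤ → ℤ
signum (+ n)    = 1ℤ
signum -[1+ n ] = -1ℤ

isUnit-signum : ∀ z → IsUnit (signum z)
isUnit-signum (+ n)    = inj₁ refl
isUnit-signum -[1+ n ] = inj₂ refl

signum*∣∣ : ∀ z → z ≡ signum z * + ∣ z ∣
signum*∣∣ (+ n)    = sym (*-identityˡ (+ n))
signum*∣∣ -[1+ n ] = sym (-1*i≡-i (+ suc n))

∣unit*∣ : ∀ {u} z → IsUnit u → ∣ u * z ∣ ≡ ∣ z ∣
∣unit*∣ {u} z u-unit = trans (abs-* u z) (trans (cong (ℕ._* ∣ z ∣) (∣unit∣≡1 u-unit)) (ℕ.*-identityˡ ∣ z ∣))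

-- With dimension `suc d` the predecessor in the boundary matrix computes: ridges are the faces of
-- index `d`, with `suc d` vertices.
module _ {n} (K : Complex n) (d : ℕ) (pseudo : IsPseudomanifoldWithoutBoundary K (suc d)) where

  open IsPseudomanifoldWithoutBoundary pseudo

  private
    facet = jFace K (suc d)
    ridge = jFace K d
    Facet = Fin (f K (suc d))
    Ridge = Fin (f K d)

  record Separates (r : Ridge) (a b : Facet) : Set where
    constructor separates
    field
      a≢b    : a ≢ b
      ⊆a     : (ridge r ⊆ᵇ facet a) ≡ true
      ⊆b     : (ridge r ⊆ᵇ facet b) ≡ true
      others : ∀ c → c ≢ a → c ≢ b → (ridge r ⊆ᵇ facet c) ≡ false

  separates-sym : ∀ {r a b} → Separates r a b → Separates r b a
  separates-sym (separates a≢b ⊆a ⊆b others) = separates (a≢b ∘ sym) ⊆b ⊆a (λ c c≢b c≢a → others c c≢a c≢b)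

  ridge-separates : ∀ r → ∃₂ λ a b → Separates r a b
  ridge-separates r with length-filterᵇ≡2 (λ τ → ridge r ⊆ᵇ τ) (faces K (suc d)) (twoFacets (ridge r) (jFace-∈ K d r) (∣jFace∣ K d r))
  ... | a , b , a≢b , ⊆a , ⊆b , others = a , b , separates a≢b ⊆a ⊆b others

  contained : ∀ {r a b} → Separates r a b → ∀ c → (ridge r ⊆ᵇ facet c) ≡ true → c ≡ a ⊎ c ≡ b
  contained {r} {a} {b} (separates _ _ _ others) c ⊆c with c ≟ a | c ≟ b
  ... | yes c≡a | _       = inj₁ c≡a
  ... | no _    | yes c≡b = inj₂ c≡b
  ... | no c≢a  | no c≢b  = contradiction (trans (sym ⊆c) (others c c≢a c≢b)) λ ()

  facetRidgeAdj-irrefl : ∀ a → facetRidgeAdj K (suc d) a a ≢ true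
  facetRidgeAdj-irrefl a aa = ℕ.1+n≢n (trans (sym (∣jFace∣ K (suc d) a))
    (trans (cong Subset.∣_∣ (sym (∩-idem (facet a)))) (≡ᵇ-true⇒≡ _ _ aa)))

  -- The intersection is a face with `suc d` vertices, hence a ridge, and both facets are among the
  -- two containing it. They differ because a facet meets itself in `suc (suc d)` vertices.
  facetRidgeAdj⇒separates : ∀ a b → facetRidgeAdj K (suc d) a b ≡ true → ∃ λ r → Separates r a b
  facetRidgeAdj⇒separates a b ab
    with jFace-surjective K d (facet a ∩ facet b)
           (simplicial (facet a) _ (∩⊆ᵇˡ (facet a) (facet b)) (jFace-∈ K (suc d) a)) (≡ᵇ-true⇒≡ _ _ ab)
  ... | r , r≡ with ridge-separates r
  ... | x , y , sep with contained sep a (trans (cong (_⊆ᵇ facet a) r≡) (∩⊆ᵇˡ (facet a) (facet b)))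
                       | contained sep b (trans (cong (_⊆ᵇ facet b) r≡) (∩⊆ᵇʳ (facet a) (facet b)))
  ... | inj₁ refl | inj₂ refl = r , sep
  ... | inj₂ refl | inj₁ refl = r , separates-sym sep
  ... | inj₁ refl | inj₁ refl = contradiction ab (facetRidgeAdj-irrefl a)
  ... | inj₂ refl | inj₂ refl = contradiction ab (facetRidgeAdj-irrefl a)

  -- The intersection contains the ridge; one more vertex would make it equal to both facets, which
  -- are distinct.
  separates⇒facetRidgeAdj : ∀ {r a b} → Separates r a b → facetRidgeAdj K (suc d) a b ≡ true
  separates⇒facetRidgeAdj {r} {a} {b} (separates a≢b ⊆a ⊆b _) = ≡⇒≡ᵇ-true (ℕ.≤-antisym upper lower)
    where
    σ τ : Subset n
    σ = facet a
    τ = facet b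
    lower : suc d ≤ Subset.∣ σ ∩ τ ∣
    lower = ℕ.≤-trans (ℕ.≤-reflexive (sym (∣jFace∣ K d r))) (⊆ᵇ⇒∣∣≤ (ridge r) (σ ∩ τ) (⊆ᵇ-∩ (ridge r) σ τ ⊆a ⊆b))
    bound : Subset.∣ σ ∩ τ ∣ ≤ suc (suc d)
    bound = ℕ.≤-trans (∣p∩q∣≤∣p∣ σ τ) (ℕ.≤-reflexive (∣jFace∣ K (suc d) a))
    not-full : Subset.∣ σ ∩ τ ∣ ≢ suc (suc d)
    not-full full = a≢b (jFace-injective K (suc d) a b (trans
      (sym (⊆ᵇ∧∣∣≡⇒≡ (σ ∩ τ) σ (∩⊆ᵇˡ σ τ) (trans full (sym (∣jFace∣ K (suc d) a)))))
      (⊆ᵇ∧∣∣≡⇒≡ (σ ∩ τ) τ (∩⊆ᵇʳ σ τ) (trans full (sym (∣jFace∣ K (suc d) b))))))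
    upper : Subset.∣ σ ∩ τ ∣ ≤ suc d
    upper = ℕ.s≤s⁻¹ (ℕ.≤∧≢⇒< bound not-full)

  -- Some facet exists, it has a ridge, and this ridge lies in two different facets. For the cycle
  -- this excludes a vertex that is its own predecessor.
  twoOrMoreFacets : 2 ≤ f K (suc d)
  twoOrMoreFacets with hasFacet
  ... | σ , σ∈K , ∣σ∣≡ with facetOf σ (suc d) ∣σ∣≡
  ... | ρ , ρ⊆σ , ∣ρ∣≡ with jFace-surjective K d ρ (simplicial σ ρ ρ⊆σ σ∈K) ∣ρ∣≡
  ... | r , _ with ridge-separates r
  ... | a , b , separates a≢b _ _ _ = at-least-two a b a≢b
    where
    at-least-two : ∀ {m} (a b : Fin m) → a ≢ b → 2 ≤ m
    at-least-two {suc zero}    zero zero a≢b = contradiction refl a≢b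
    at-least-two {suc (suc m)} a    b    a≢b = s≤s (s≤s z≤n)

  ∂-isUnit : ∀ r a → (ridge r ⊆ᵇ facet a) ≡ true → IsUnit (∂ K (suc d) r a)
  ∂-isUnit r a ⊆a = bdCoeff-⊆ (ridge r) (facet a) ⊆a (trans (∣jFace∣ K (suc d) a) (cong suc (sym (∣jFace∣ K d r))))

  ∂-zero : ∀ {r a b} → Separates r a b → ∀ c → c ≢ a → c ≢ b → ∂ K (suc d) r c ≡ 0ℤ
  ∂-zero {r} sep c c≢a c≢b = bdCoeff-⊈ (ridge r) (facet c) (Separates.others sep c c≢a c≢b)

  module Orientation (z : Facet → ℤ) (z-cycle : IsCycle K (suc d) z) (z≢0 : ¬ (∀ c → z c ≡ + 0)) where

    ∂-balance : ∀ {r a b} → Separates r a b → ∂ K (suc d) r a * z a + ∂ K (suc d) r b * z b ≡ 0ℤ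
    ∂-balance {r} {a} {b} sep = begin
      ∂ K (suc d) r a * z a + ∂ K (suc d) r b * z b    ≡⟨ sum-pair a b (λ c → ∂ K (suc d) r c * z c) (Separates.a≢b sep)
        (λ c c≢a c≢b → trans (cong (_* z c) (∂-zero sep c c≢a c≢b)) (*-zeroˡ (z c))) ⟨
      sum (λ c → ∂ K (suc d) r c * z c)                ≡⟨ foldr-map-tabulate (f K (suc d)) id (λ c → ∂ K (suc d) r c * z c) ⟨
      -- The underscore is the sum in `IsCycle`, a local function that unfolds to the `foldr` of
      -- `foldr-map-tabulate`.
      _                                                ≡⟨ z-cycle r ⟨
      0ℤ                                               ∎
      where open ≡-Reasoning

    ∣z∣-constant : ∀ {r a b} → Separates r a b → ∣ z a ∣ ≡ ∣ z b ∣
    ∣z∣-constant {r} {a} {b} sep@(separates _ ⊆a ⊆b _) = begin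
      ∣ z a ∣                          ≡⟨ ∣unit*∣ (z a) (∂-isUnit r a ⊆a) ⟨
      ∣ ∂ K (suc d) r a * z a ∣        ≡⟨ cong ∣_∣ (x+y≡0⇒x≡-y (∂ K (suc d) r a * z a) _ (∂-balance sep)) ⟩
      ∣ - (∂ K (suc d) r b * z b) ∣    ≡⟨ ∣-i∣≡∣i∣ (∂ K (suc d) r b * z b) ⟩
      ∣ ∂ K (suc d) r b * z b ∣        ≡⟨ ∣unit*∣ (z b) (∂-isUnit r b ⊆b) ⟩
      ∣ z b ∣                          ∎
      where
      open ≡-Reasoning
      x+y≡0⇒x≡-y : ∀ x y → x + y ≡ 0ℤ → x ≡ - y
      x+y≡0⇒x≡-y x y eq = trans (regroup x y) (trans (cong (_- y) eq) (+-identityˡ (- y)))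
        where
        regroup : ∀ x y → x ≡ x + y - y
        regroup = solve-∀

    -- The modulus is constant along facet-ridge paths, so a single zero would make `z` vanish
    -- everywhere.
    z-nonzero : ∀ a → z a ≢ 0ℤ
    z-nonzero a za≡0 = z≢0 λ c → ∣i∣≡0⇒i≡0 (trans (sym (along (strongConn a c))) (cong ∣_∣ za≡0))
      where
      along : ∀ {a c} → Star (λ x y → facetRidgeAdj K (suc d) x y ≡ true) a c → ∣ z a ∣ ≡ ∣ z c ∣
      along ε = refl
      along {a} (_◅_ {j = b} ab path) = trans (∣z∣-constant (proj₂ (facetRidgeAdj⇒separates a b ab))) (along path)

    orient : Facet → ℤ
    orient a = signum (z a)

    oriented∂ : Ridge → Facet → ℤ
    oriented∂ r a = ∂ K (suc d) r a * orient a

    -- This is `∂-balance` divided by the common modulus of `z a` and `z b`, which is nonzero; ℤ has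
    -- no zero divisors.
    oriented∂-balance : ∀ {r a b} → Separates r a b → oriented∂ r a + oriented∂ r b ≡ 0ℤ
    oriented∂-balance {r} {a} {b} sep = [ id , (λ ∣za∣≡0 → contradiction (∣i∣≡0⇒i≡0 (+-injective ∣za∣≡0)) (z-nonzero a)) ]′
      (i*j≡0⇒i≡0∨j≡0 (oriented∂ r a + oriented∂ r b) product≡0)
      where
      open ≡-Reasoning
      x = ∂ K (suc d) r a
      y = ∂ K (suc d) r b
      distrib : ∀ x e y e′ m → (x * e + y * e′) * m ≡ x * (e * m) + y * (e′ * m)
      distrib = solve-∀
      product≡0 : (oriented∂ r a + oriented∂ r b) * + ∣ z a ∣ ≡ 0ℤ
      product≡0 = begin
        (oriented∂ r a + oriented∂ r b) * + ∣ z a ∣    ≡⟨ distrib x (orient a) y (orient b) (+ ∣ z a ∣) ⟩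
        x * (orient a * + ∣ z a ∣) + y * (orient b * + ∣ z a ∣)
          ≡⟨ cong₂ (λ p q → x * p + y * q) (sym (signum*∣∣ (z a)))
               (trans (cong (λ m → orient b * + m) (∣z∣-constant sep)) (sym (signum*∣∣ (z b)))) ⟩
        x * z a + y * z b                              ≡⟨ ∂-balance sep ⟩
        0ℤ                                             ∎

    separates⇒isEdge : ∀ {r a b} → Separates r a b → IsEdge (oriented∂ r) a b
    separates⇒isEdge {r} {a} {b} sep@(separates a≢b ⊆a _ _) =
      oriented∂ r a , isUnit-* (∂-isUnit r a ⊆a) (isUnit-signum (z a)) , row
      where
      scale-1 : ∀ u → u ≡ u * (1ℤ - 0ℤ)
      scale-1 = solve-∀
      -- Solved for the entry at `b`: since the two entries sum to zero, it is the entry at `a`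
      -- times -1, as `IsEdge` demands.
      scale-neg : ∀ u v → v ≡ (u + v) + u * (0ℤ - 1ℤ)
      scale-neg = solve-∀
      row : ∀ c → oriented∂ r c ≡ oriented∂ r a * (δ a c - δ b c)
      row c with a ≟ c | b ≟ c
      ... | yes refl | yes refl = contradiction refl a≢b
      ... | yes refl | no _     = scale-1 (oriented∂ r a)
      ... | no _     | yes refl = trans (scale-neg (oriented∂ r a) (oriented∂ r b))
        (trans (cong (_+ oriented∂ r a * (0ℤ - 1ℤ)) (oriented∂-balance sep)) (+-identityˡ _))
      ... | no a≢c   | no b≢c   = trans
        (trans (cong (_* orient c) (∂-zero sep c (a≢c ∘ sym) (b≢c ∘ sym))) (*-zeroˡ (orient c)))
        (sym (*-zeroʳ (oriented∂ r a)))

    oriented∂-edges : ∀ r → ∃₂ λ a b → IsEdge (oriented∂ r) a b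
    oriented∂-edges r with ridge-separates r
    ... | a , b , sep = a , b , separates⇒isEdge sep

    adjacent : ∀ {a b} → ∃ (λ r → Separates r a b) → Adjacent oriented∂ a b
    adjacent (r , sep) = r , separates⇒isEdge sep

    oriented∂-connected : ∀ a b → Star (Adjacent oriented∂) a b
    oriented∂-connected a b = Star.map (λ {x} {y} xy → adjacent (facetRidgeAdj⇒separates x y xy)) (strongConn a b)

    ∂-unorient : ∀ r a → ∂ K (suc d) r a ≡ orient a * oriented∂ r a
    ∂-unorient r a = sym (trans (rotate (orient a) (∂ K (suc d) r a)) (isUnit-cancel (isUnit-signum (z a)) _))
      where
      rotate : ∀ e x → e * (x * e) ≡ e * (e * x)
      rotate = solve-∀

    Psub-unimodEquiv : UnimodEquiv (Psub K (suc d)) (SymEdgePoly (cycleAdj (f K (suc d))))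
    Psub-unimodEquiv = unimodEquiv-cycle (cyclicOrder twoOrMoreFacets) (λ a r → ∂ K (suc d) r a) oriented∂
      ((λ a → a , orient a , isUnit-signum (z a) , λ r → ∂-unorient r a) ,
       (λ a → a , orient a , isUnit-signum (z a) , λ r → ∂-unorient r a))
      oriented∂-edges oriented∂-connected

    Psup-unimodEquiv : UnimodEquiv (Psup K (suc d)) (SymEdgePoly (facetRidgeAdj K (suc d)))
    Psup-unimodEquiv = unimodEquiv-graph (facetRidgeAdj K (suc d)) (λ r a → ∂ K (suc d) r a)
      orient (isUnit-signum ∘ z) oriented∂ ∂-unorient edges (λ a b ab → adjacent (facetRidgeAdj⇒separates a b ab))
      where
      edges : ∀ r → ∃₂ λ a b → a ≢ b × facetRidgeAdj K (suc d) a b ≡ true × facetRidgeAdj K (suc d) b a ≡ true ×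
        IsEdge (oriented∂ r) a b
      edges r with ridge-separates r
      ... | a , b , sep = a , b , Separates.a≢b sep , separates⇒facetRidgeAdj sep ,
        separates⇒facetRidgeAdj (separates-sym sep) , separates⇒isEdge sep

theorem8p3 : (n d : ℕ) (Δ : Complex n) → 1 ≤ d →
    IsOrientablePseudomanifoldWithoutBoundary Δ d →
    UnimodEquiv (Psub Δ d) (SymEdgePoly (cycleAdj (f Δ d)))
    × UnimodEquiv (Psup Δ d) (SymEdgePoly (facetRidgeAdj Δ d))
theorem8p3 n (suc d) Δ 1≤d record { pseudo = pseudo ; orientable = z , z-cycle , z≢0 , _ } =
  Psub-unimodEquiv , Psup-unimodEquiv
  where open Orientation Δ d pseudo z z-cycle z≢0
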